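{- Let $G$ be a finite connected graph (parallel edges and loops allowed). Then $G$ is double ear decomposable if and only if $\operatorname{tw}(G) \leq 2$ and $\deg_G(v) \in \{2,4\}$ for every node $v$ of $G$.
   Context: Graphs are finite, nonempty and connected, and may contain parallel edges and loops; a loop contributes $2$ to the degree of its endnode. A cycle may have length one (a single node with one loop) or length two (two nodes joined by two parallel edges). A path has pairwise distinct nodes. Simple subdivision: $G'$ is a simple subdivision of $G$ if it is obtained from $G$ by replacing one edge with endnodes $u$ and $w$ (possibly $u=w$) by a path $uvw$ through a new node $v$, i.e. by the two edges $uv$ and $vw$. Adding a double ear: Let $G$ contain a path $P = v_1 \cdots v_r$ ($r \geq 1$) with $\deg_G(v_i)=2$ for all $i=1,\dots,r$. Adding a double ear to $P$ means: (1) connect the first and the last node of $P$ by a new edge, and (2) duplicate each edge of $P$ (add one new parallel copy). If $r=1$ (path without edges), this means that a loop is added at $v_1$. A double ear decomposition of $G_k$ starting with $G_0$ is a finite sequence $(G_0,G_1,\dots,G_k)$ of graphs such that for each $i=1,\dots,k$, either $G_i$ is obtained from $G_{i-1}$ by adding a double ear (double ear step), or $G_i$ is a simple subdivision of $G_{i-1}$ (subdivision step). A graph $G$ is double ear decomposable if there is a double ear decomposition of $G$ starting with a cycle $G_0$. $\operatorname{tw}(G)$ is the usual treewidth: the minimum of $\max_{i\in I}|X_i|-1$ over all tree decompositions $(\{X_i : i\in I\}, T=(I,F))$ of $G$; parallel edges and loops do not affect it. -}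

module Defs where

open import Data.Bool.Base using (if_then_else_)
open import Data.Fin.Base using (Fin; zero; suc; inject₁; fromℕ)
open import Data.Fin.Properties using (_≟_)
open import Data.Fin.Subset using (Subset; _∈_; ∣_∣)
open import Data.Nat.Base using (ℕ; zero; suc; _+_; _∸_; _⊔_; _≤_)
open import Data.Nat.Properties using (+-0-commutativeMonoid)
open import Data.Product.Base using (Σ; ∃; ∃-syntax; _×_; _,_; proj₁; proj₂; map; swap)
open import Data.Sum.Base using (_⊎_)
open import Data.Vec.Functional using (Vector; _∷_; _++_; foldr; updateAt)
open import Algebra.Properties.CommutativeMonoid.Sum +-0-commutativeMonoid using (sum)
open import Function.Base using (_∘_; const)
open import Function.Bundles using (_↔_; Inverse)
open import Function.Definitions using (Injective)
open import Relation.Binary.Construct.Closure.ReflexiveTransitive using (Star)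
open import Relation.Binary.PropositionalEquality.Core using (_≡_)
open import Relation.Nullary.Decidable.Core using (does)
open import Relation.Nullary.Negation.Core using (¬_)

-- Finite multigraphs. Edges have an identity of their own, so parallel edges
-- and loops are allowed; they are undirected, so the order in which `ends`
-- lists the two endnodes carries no meaning: see _∼_.

record Graph : Set where
  field
    #nodes : ℕ
    #edges : ℕ
    ends   : Vector (Fin #nodes × Fin #nodes) #edges

  Node : Set
  Node = Fin #nodes

  Edge : Set
  Edge = Fin #edges

open Graph public using (Node; Edge)

_∼_ : {A : Set} → A × A → A × A → Set
p ∼ q = p ≡ q ⊎ p ≡ swap q

Adjacent : (G : Graph) → Node G → Node G → Set
Adjacent G u w = ∃[ e ] Graph.ends G e ∼ (u , w)

record Connected (G : Graph) : Set where
  field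
    someNode  : Node G
    reachable : ∀ u w → Star (Adjacent G) u w

[_≟_] : ∀ {n} → Fin n → Fin n → ℕ
[ u ≟ v ] = if does (u ≟ v) then 1 else 0

-- A loop at v contributes 1 + 1.
deg : (G : Graph) → Node G → ℕ
deg G v = sum λ e → [ proj₁ (ends e) ≟ v ] + [ proj₂ (ends e) ≟ v ]
  where open Graph G

record Hom (G H : Graph) : Set where
  field
    node      : Node G → Node H
    edge      : Edge G → Edge H
    preserves : ∀ e → Graph.ends H (edge e) ∼ map node node (Graph.ends G e)

-- G is isomorphic to a (not necessarily induced) subgraph of H.
record _↪ᴳ_ (G H : Graph) : Set where
  field
    hom            : Hom G H
    node-injective : Injective _≡_ _≡_ (Hom.node hom)
    edge-injective : Injective _≡_ _≡_ (Hom.edge hom)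

  open Hom hom public

record _≅_ (G H : Graph) : Set where
  field
    nodes     : Node G ↔ Node H
    edges     : Edge G ↔ Edge H
    preserves : ∀ e → Graph.ends H (Inverse.to edges e)
                        ∼ map (Inverse.to nodes) (Inverse.to nodes) (Graph.ends G e)

-- The path with k edges and k + 1 nodes.
pathGraph : ℕ → Graph
pathGraph k = record
  { #nodes = suc k
  ; #edges = k
  ; ends   = λ i → inject₁ i , suc i
  }

-- The cycle of length k + 1: a loop for k = 0, two parallel edges for k = 1.
cycleGraph : ℕ → Graph
cycleGraph k = record
  { #nodes = suc k
  ; #edges = suc k
  ; ends   = (fromℕ k , zero) ∷ λ i → inject₁ i , suc i
  }

IsCycle : Graph → Set
IsCycle G = ∃[ k ] G ≅ cycleGraph k

-- Since there may be parallel edges, a path comprises a choice of edges as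
-- well as of nodes.
Path : Graph → ℕ → Set
Path G k = pathGraph k ↪ᴳ G

-- The edge e = uw becomes uv, and vw is added; v is the new node `zero`.
subdivide : (G : Graph) → Edge G → Graph
subdivide G e = record
  { #nodes = suc #nodes
  ; #edges = suc #edges
  ; ends   = (zero , suc w) ∷ updateAt (map suc suc ∘ ends) e (const (suc u , zero))
  }
  where
  open Graph G
  u = proj₁ (ends e)
  w = proj₂ (ends e)

-- For k = 0 the edge joining the first and the last node of P is a loop.
addDoubleEar : (G : Graph) {k : ℕ} → Path G k → Graph
addDoubleEar G {k} P = record
  { #nodes = #nodes
  ; #edges = #edges + suc k
  ; ends   = ends ++ ((node zero , node (fromℕ k)) ∷ (ends ∘ edge))
  }
  where
  open Graph G
  open _↪ᴳ_ P

-- Graphs obtained by a construction are understood up to isomorphism.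
data Step (G H : Graph) : Set where
  doubleEarStep   : ∀ {k} (P : Path G k) →
                    (∀ i → deg G (_↪ᴳ_.node P i) ≡ 2) →
                    H ≅ addDoubleEar G P → Step G H
  subdivisionStep : (e : Edge G) → H ≅ subdivide G e → Step G H

DoubleEarDecomposition : Graph → Graph → Set
DoubleEarDecomposition = Star Step

DoubleEarDecomposable : Graph → Set
DoubleEarDecomposable G = ∃[ G₀ ] IsCycle G₀ × DoubleEarDecomposition G₀ G

-- Excluding cycles of length one and two makes a tree a simple graph.
Acyclic : Graph → Set
Acyclic G = ∀ k → ¬ (cycleGraph k ↪ᴳ G)

IsTree : Graph → Set
IsTree T = Connected T × Acyclic T

-- The nodes satisfying P induce a connected (or empty) subgraph of G.
InducesConnected : (G : Graph) → (Node G → Set) → Set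
InducesConnected G P =
  ∀ u w → P u → P w → Star (λ a b → P a × P b × Adjacent G a b) u w

record TreeDecomposition (G : Graph) : Set where
  open Graph G using (#nodes; ends)
  field
    tree          : Graph
    isTree        : IsTree tree
    bag           : Node tree → Subset #nodes
    coversNodes   : ∀ v → ∃[ i ] v ∈ bag i
    coversEdges   : ∀ e → ∃[ i ] (proj₁ (ends e) ∈ bag i × proj₂ (ends e) ∈ bag i)
    bagsConnected : ∀ v → InducesConnected tree (λ i → v ∈ bag i)

  -- The truncated subtraction is exact as soon as G has a node.
  width : ℕ
  width = foldr _⊔_ 0 (λ i → ∣ bag i ∣) ∸ 1

-- tw(G) is a minimum of widths, so it is at most k exactly when one of these
-- widths is.
tw[_]≤_ : Graph → ℕ → Set
tw[ G ]≤ k = Σ (TreeDecomposition G) λ D → TreeDecomposition.width D ≤ k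

{-# OPTIONS --safe #-}

module Submission where

-- Both kinds of steps preserve the two conditions: contracting the path of a double ear
-- to its first edge leaves a tree decomposition to which the path is added back as a fan
-- of bags, and a double ear raises the degree of each node of its path from 2 to 4.
--
-- Conversely, a step is undone. A node of degree 2 is suppressed unless it carries a
-- loop, in which case it is the whole graph. If all degrees are 4, a loop is a double ear
-- on one node, and a triple edge contains one on two nodes. Otherwise a tree
-- decomposition of width 2 provides a node v with at most two neighbours a and b, joined
-- to it by two edges each. If a and b are adjacent, the path avb with the chord ab is a
-- double ear; if not, replace the double edges av and vb by a double edge ab. A long
-- double ear of the smaller graph gives one of the original graph.

open import Defs
open import Data.Fin.Base using (Fin; zero; suc; inject₁; fromℕ; splitAt; punchIn; punchOut)
open import Data.Fin.Permutation as Perm using (insert; insert-punchIn; ↔⇒≡; _⟨$⟩ʳ_)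
open import Data.Fin.Properties
  using (_≟_; any?; all?; ¬∀⟶∃¬; suc-injective; inject₁-injective; fromℕ≢inject₁; injective⇒≤; punchIn-injective;
         punchInᵢ≢i; punchIn-punchOut; punchOut-injective; punchOut-cong; +↔⊎)
open import Data.Fin.Relation.Unary.Top using (view; ‵fromℕ; ‵inject₁)
open import Data.Fin.Subset as Subset using (Subset; ∣_∣; ⁅_⁆; _∪_; ⋃; inside; outside)
open import Data.Fin.Subset.Properties using (x∈⁅x⁆; x∈⁅y⁆⇒x≡y; x∈p∪q⁺; x∈p∪q⁻; ∉⊥; ∣⊥∣≡0; ∣⁅x⁆∣≡1)
open import Data.List.Base as List using (List; []; _∷_; _∷ʳ_; length; lookup; filter; allFin)
import Data.List.Membership.DecPropositional as DecMembership
open import Data.List.Membership.Propositional using (_∈_; _∉_; find; lose)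
open import Data.List.Membership.Propositional.Properties using (∈-map⁺; ∈-map⁻; ∈-lookup; ∈-filter⁺; ∈-allFin)
open import Data.List.Properties using (length-map; filter-notAll)
open import Data.List.Relation.Unary.All as All using (All; []; _∷_)
import Data.List.Relation.Unary.All.Properties as All
open import Data.List.Relation.Unary.All.Properties using (¬Any⇒All¬; All¬⇒¬Any; ¬All⇒Any¬; ++⁺)
open import Data.List.Relation.Unary.AllPairs using ([]; _∷_)
open import Data.List.Relation.Unary.Any using (here; there)
open import Data.List.Relation.Unary.Unique.Propositional using (Unique)
import Data.List.Relation.Unary.Unique.Propositional.Properties as Unique
open import Data.Nat.Base using (ℕ; zero; suc; _+_; _*_; _⊔_; _≤_; _<_; z≤n; s≤s; s≤s⁻¹)
import Data.Nat.Properties as ℕ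
open import Algebra.Properties.CommutativeMonoid.Sum ℕ.+-0-commutativeMonoid
  using (sum; sum-cong-≗; sum-permute; sum-init-last; ∑-distrib-+; sum-replicate-zero)
open import Data.Nat.Tactic.RingSolver using (solve-∀)
open import Data.Product.Base using (∃₂; ∃-syntax; _×_; _,_; proj₁; proj₂; map; map₁; swap)
open import Data.Product.Properties using (≡-dec)
open import Data.Sum.Base as Sum using (_⊎_; inj₁; inj₂; [_,_])
open import Data.Vec.Base using ([]; _∷_; here; there)
open import Data.Vec.Functional using (Vector; updateAt; foldr; _++_) renaming (_∷_ to _∷ᶠ_)
open import Data.Vec.Functional.Properties using (updateAt-updates; updateAt-minimal)
open import Function.Base using (_∘_; id; const)
open import Function.Bundles using (Inverse; _↔_; _⇔_; mk↔ₛ′; mk⤖; mk⇔)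
open import Function.Definitions using (Injective; Surjective)
open import Function.Properties.Bijection using (⤖⇒↔)
open import Function.Properties.Inverse using (↔-refl; ↔-sym; ↔-trans)
open import Relation.Binary.Construct.Closure.ReflexiveTransitive as Star using (Star; ε; _◅_; _◅◅_)
open import Relation.Binary.Definitions using (DecidableEquality)
open import Relation.Binary.PropositionalEquality
  using (_≡_; _≢_; refl; sym; trans; cong; cong₂; subst; subst₂; ≢-sym; module ≡-Reasoning)
open import Relation.Nullary using (¬_; Dec; yes; no; contradiction)
open import Relation.Nullary.Decidable using (¬?; _×-dec_; _⊎-dec_)

-- The two ends of the path of a double ear need not share a bag, yet the chord joins them.
-- Contracting all edges of the path but one makes the chord parallel to the remaining edge, and
-- nothing else is lost, since an interior node of degree 2 has no edges off the path. In the
-- converse, width 2 yields a bag with a node and all its neighbours, hence at most two of them;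
-- four edges to two neighbours without a triple edge form two double edges. A new double edge `ab`
-- restores the degrees of `a` and `b` to 4, and creates no higher multiplicity exactly because they
-- were not adjacent. If they are adjacent, deleting the chord and one copy each of `av` and `vb`
-- leaves all three nodes with degree 2, as a double ear demands. These replacements are never
-- carried out on graphs: only the relations of being joined by at least one and by at least two
-- edges are followed, on an unchanged type of nodes. A triple edge is one of the original graph and
-- ends the search. A long ear has at least two edges on its path, so that its chord and its doubled
-- edges are told apart by their ends.

∼-sym : {A : Set} {p q : A × A} → p ∼ q → q ∼ p
∼-sym (inj₁ refl) = inj₁ refl
∼-sym (inj₂ refl) = inj₂ refl

∼-trans : {A : Set} {p q r : A × A} → p ∼ q → q ∼ r → p ∼ r
∼-trans (inj₁ refl) q∼r         = q∼r
∼-trans (inj₂ refl) (inj₁ refl) = inj₂ refl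
∼-trans (inj₂ refl) (inj₂ refl) = inj₁ refl

∼-swap : {A : Set} {p q : A × A} → p ∼ q → p ∼ swap q
∼-swap (inj₁ refl) = inj₂ refl
∼-swap (inj₂ refl) = inj₁ refl

∼-map : {A B : Set} (f : A → B) {p q : A × A} → p ∼ q → map f f p ∼ map f f q
∼-map f (inj₁ refl) = inj₁ refl
∼-map f (inj₂ refl) = inj₂ refl

∼-unmap : {A B : Set} {f : A → B} → Injective _≡_ _≡_ f →
          {p q : A × A} → map f f p ∼ map f f q → p ∼ q
∼-unmap inj (inj₁ eq) = inj₁ (cong₂ _,_ (inj (cong proj₁ eq)) (inj (cong proj₂ eq)))
∼-unmap inj (inj₂ eq) = inj₂ (cong₂ _,_ (inj (cong proj₁ eq)) (inj (cong proj₂ eq)))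

Joins : (G : Graph) → Edge G → Node G → Node G → Set
Joins G e u w = Graph.ends G e ∼ (u , w)

adjacent-sym : (G : Graph) {u w : Node G} → Adjacent G u w → Adjacent G w u
adjacent-sym G (e , j) = e , ∼-swap j

inject₁≢suc : ∀ {n} (i : Fin n) → inject₁ i ≢ suc i
inject₁≢suc (suc i) = inject₁≢suc i ∘ suc-injective

chain : {A : Set} {R : A → A → Set} {k : ℕ} (g : Fin (suc k) → A) →
        (∀ i → R (g (inject₁ i)) (g (suc i))) → ∀ i → Star R (g zero) (g i)
chain             g step zero    = ε
chain {k = suc k} g step (suc i) = step zero ◅ chain (g ∘ suc) (step ∘ suc) i

-- Tree decompositions and their minors

-- Tree decompositions of width at most two, with lists for bags: the image of a
-- bag under a map of nodes is then no larger, so that the tree decompositions of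
-- minors are obtained without changing the tree.
record Decomposition (T : Graph) (V : Set) : Set where
  field
    bag       : Node T → List V
    small     : ∀ i → length (bag i) ≤ 3
    connected : ∀ v → InducesConnected T (λ i → v ∈ bag i)

  Together : V → V → Set
  Together u w = ∃[ i ] (u ∈ bag i × w ∈ bag i)

  together-sym : ∀ {u w} → Together u w → Together w u
  together-sym (i , u∈ , w∈) = i , w∈ , u∈

open Decomposition using (Together)

module _ {T : Graph} {V W : Set} (D : Decomposition T V) (f : V → W)
         (fibres : ∀ {u w} → f u ≡ f w → Star (λ a b → f a ≡ f b × Together D a b) u w)
         where

  open Decomposition D hiding (Together)

  private
    mapped : Node T → List W
    mapped = List.map f ∘ bag

    inMapped : ∀ v {i j} → Star (λ a b → v ∈ bag a × v ∈ bag b × Adjacent T a b) i j →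
               Star (λ a b → f v ∈ mapped a × f v ∈ mapped b × Adjacent T a b) i j
    inMapped v = Star.map λ { (v∈a , v∈b , ab) → ∈-map⁺ f v∈a , ∈-map⁺ f v∈b , ab }

    -- The members of a fibre are chained by shared bags, and the bags of each member are connected;
    -- hence so is the union over the fibre.
    inFibre : ∀ {v w i j} → v ∈ bag i → w ∈ bag j →
              Star (λ a b → f a ≡ f b × Together D a b) v w →
              Star (λ a b → f w ∈ mapped a × f w ∈ mapped b × Adjacent T a b) i j
    inFibre {v} v∈i v∈j ε = inMapped v (connected v _ _ v∈i v∈j)
    inFibre {v} {w} {i} v∈i w∈j ((fv≡fu , k , v∈k , u∈k) ◅ rest) =
      subst (λ x → Star (λ a b → x ∈ mapped a × x ∈ mapped b × Adjacent T a b) i k)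
            (trans fv≡fu (same rest)) (inMapped v (connected v _ _ v∈i v∈k))
      ◅◅ inFibre u∈k w∈j rest
      where
      same : ∀ {a b} → Star (λ a b → f a ≡ f b × Together D a b) a b → f a ≡ f b
      same ε                = refl
      same ((eq , _) ◅ abs) = trans eq (same abs)

  minor : Decomposition T W
  minor = record
    { bag       = mapped
    ; small     = λ i → subst (_≤ 3) (sym (length-map f (bag i))) (small i)
    ; connected = connected′
    }
    where
    connected′ : ∀ w → InducesConnected T (λ i → w ∈ mapped i)
    connected′ x i j x∈i x∈j with ∈-map⁻ f x∈i | ∈-map⁻ f x∈j
    ... | u , u∈i , refl | w , w∈j , fu≡fw rewrite fu≡fw = inFibre u∈i w∈j (fibres fu≡fw)

  minor-together : ∀ {u w} → Together D u w → Together minor (f u) (f w)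
  minor-together (i , u∈i , w∈i) = i , ∈-map⁺ f u∈i , ∈-map⁺ f w∈i

-- Attaching a leaf to a tree, and a bag to a decomposition

attach : (T : Graph) → Node T → Graph
attach T i = record
  { #nodes = suc #nodes
  ; #edges = suc #edges
  ; ends   = (zero , suc i) ∷ᶠ (map suc suc ∘ ends)
  }
  where open Graph T

module _ {T : Graph} {i : Node T} where

  attach-adjacent : ∀ {a b} → Adjacent T a b → Adjacent (attach T i) (suc a) (suc b)
  attach-adjacent (e , j) = suc e , ∼-map suc j

  attach-leaf : Adjacent (attach T i) zero (suc i)
  attach-leaf = zero , inj₁ refl

  attach-connected : Connected T → Connected (attach T i)
  attach-connected C = record { someNode = zero ; reachable = reachable′ }
    where
    open Connected C
    lifted : ∀ u w → Star (Adjacent (attach T i)) (suc u) (suc w)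
    lifted u w = Star.gmap suc attach-adjacent (reachable u w)
    reachable′ : ∀ u w → Star (Adjacent (attach T i)) u w
    reachable′ zero    zero    = ε
    reachable′ zero    (suc w) = attach-leaf ◅ lifted i w
    reachable′ (suc u) zero    = lifted u i ◅◅ adjacent-sym (attach T i) attach-leaf ◅ ε
    reachable′ (suc u) (suc w) = lifted u w

  -- Every node of a cycle other than a loop is on two of its edges, whereas the
  -- new node is on one edge only.
  cycleInAttach : ∀ {k} (C : cycleGraph k ↪ᴳ attach T i) → ∀ a → _↪ᴳ_.node C a ≢ zero
  cycleInAttach {zero} C zero eq with _↪ᴳ_.edge C zero in eqₑ | _↪ᴳ_.preserves C zero
  ... | zero  | inj₁ p rewrite eq = contradiction (cong proj₂ p) λ ()
  ... | zero  | inj₂ p rewrite eq = contradiction (cong proj₂ p) λ ()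
  ... | suc e | inj₁ p rewrite eq = contradiction (cong proj₁ p) λ ()
  ... | suc e | inj₂ p rewrite eq = contradiction (cong proj₁ p) λ ()
  cycleInAttach {suc k} C a eq with twoEdges a
    where
    Incident : ∀ {k} → Fin (suc k) → Fin (suc k) → Set
    Incident {k} e a = proj₁ (Graph.ends (cycleGraph k) e) ≡ a ⊎ proj₂ (Graph.ends (cycleGraph k) e) ≡ a
    twoEdges : ∀ {k} (a : Fin (suc (suc k))) → ∃₂ λ e e′ → e ≢ e′ × Incident e a × Incident e′ a
    twoEdges zero    = zero , suc zero , (λ ()) , inj₂ refl , inj₁ refl
    twoEdges (suc a) with view a
    ... | ‵fromℕ     = zero , suc a , (λ ()) , inj₁ refl , inj₂ refl
    ... | ‵inject₁ b = suc a , suc (suc b) , inject₁≢suc b ∘ suc-injective , inj₂ refl , inj₁ refl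
  ... | e , e′ , e≢e′ , inc , inc′ = e≢e′ (edge-injective (trans (only e inc) (sym (only e′ inc′))))
    where
    open _↪ᴳ_ C
    only : ∀ e → proj₁ (Graph.ends (cycleGraph (suc k)) e) ≡ a ⊎ proj₂ (Graph.ends (cycleGraph (suc k)) e) ≡ a →
           edge e ≡ zero
    only e inc with edge e in eqₑ | preserves e | inc
    ... | zero  | _      | _         = refl
    ... | suc _ | inj₁ p | inj₁ refl rewrite eq = contradiction (cong proj₁ p) λ ()
    ... | suc _ | inj₁ p | inj₂ refl rewrite eq = contradiction (cong proj₂ p) λ ()
    ... | suc _ | inj₂ p | inj₁ refl rewrite eq = contradiction (cong proj₂ p) λ ()
    ... | suc _ | inj₂ p | inj₂ refl rewrite eq = contradiction (cong proj₁ p) λ ()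

  -- A cycle avoids the new leaf, hence also the new edge, and so lies in `T`.
  attach-acyclic : Acyclic T → Acyclic (attach T i)
  attach-acyclic acyclic k C = acyclic k restricted
    where
    open _↪ᴳ_ C

    lower : ∀ {n} (x : Fin (suc n)) → x ≢ zero → ∃[ y ] x ≡ suc y
    lower zero    x≢0 = contradiction refl x≢0
    lower (suc y) _   = y , refl

    node′ : ∀ a → ∃[ x ] node a ≡ suc x
    node′ a = lower (node a) (cycleInAttach C a)

    edge≢0 : ∀ e → edge e ≢ zero
    edge≢0 e eq with preserves e
    ... | p rewrite eq with p
    ...   | inj₁ q = cycleInAttach C _ (sym (cong proj₁ q))
    ...   | inj₂ q = cycleInAttach C _ (sym (cong proj₁ q))

    edge′ : ∀ e → ∃[ x ] edge e ≡ suc x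
    edge′ e = lower (edge e) (edge≢0 e)

    restricted : cycleGraph k ↪ᴳ T
    restricted = record
      { hom            = record
        { node      = proj₁ ∘ node′
        ; edge      = proj₁ ∘ edge′
        ; preserves = λ e → ∼-unmap suc-injective (subst₂ _∼_
            (cong (Graph.ends (attach T i)) (proj₂ (edge′ e)))
            (cong₂ _,_ (proj₂ (node′ _)) (proj₂ (node′ _))) (preserves e))
        }
      ; node-injective = λ {a} {b} eq → node-injective
          (trans (proj₂ (node′ a)) (trans (cong suc eq) (sym (proj₂ (node′ b)))))
      ; edge-injective = λ {a} {b} eq → edge-injective
          (trans (proj₂ (edge′ a)) (trans (cong suc eq) (sym (proj₂ (edge′ b)))))
      }

  attach-isTree : IsTree T → IsTree (attach T i)
  attach-isTree (connected , acyclic) = attach-connected connected , attach-acyclic acyclic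

module _ {T : Graph} {V : Set} (D : Decomposition T V) (i : Node T) (L : List V)
         (L-small : length L ≤ 3)
         (L-near : ∀ {v} → v ∈ L → v ∈ Decomposition.bag D i ⊎ (∀ j → v ∉ Decomposition.bag D j))
         where

  open Decomposition D hiding (Together)

  private
    bag′ : Node (attach T i) → List V
    bag′ zero    = L
    bag′ (suc j) = bag j

    Inside : V → Node (attach T i) → Node (attach T i) → Set
    Inside v a b = v ∈ bag′ a × v ∈ bag′ b × Adjacent (attach T i) a b

    lifted : ∀ v {a b} → v ∈ bag a → v ∈ bag b → Star (Inside v) (suc a) (suc b)
    lifted v v∈a v∈b = Star.gmap suc (λ { (x , y , ab) → x , y , attach-adjacent ab })
                                 (connected v _ _ v∈a v∈b)

    connected′ : ∀ v → InducesConnected (attach T i) (λ a → v ∈ bag′ a)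
    connected′ v zero    zero    _   _   = ε
    connected′ v zero    (suc b) v∈L v∈b with L-near v∈L
    ... | inj₁ v∈i = (v∈L , v∈i , attach-leaf) ◅ lifted v v∈i v∈b
    ... | inj₂ new = contradiction v∈b (new b)
    connected′ v (suc a) zero    v∈a v∈L with L-near v∈L
    ... | inj₁ v∈i = lifted v v∈a v∈i
                     ◅◅ (v∈i , v∈L , adjacent-sym (attach T i) attach-leaf) ◅ ε
    ... | inj₂ new = contradiction v∈a (new a)
    connected′ v (suc a) (suc b) v∈a v∈b = lifted v v∈a v∈b

  -- `L-near` keeps the occurrences of each node connected: a member of the new bag is either in the
  -- bag next to it or in no old bag at all.
  attachBag : Decomposition (attach T i) V
  attachBag = record
    { bag       = bag′
    ; small     = λ { zero → L-small ; (suc j) → small j }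
    ; connected = connected′
    }

  attachBag-old : ∀ {u w} → Together D u w → Together attachBag u w
  attachBag-old (j , u∈ , w∈) = suc j , u∈ , w∈

  attachBag-new : ∀ {u w} → u ∈ L → w ∈ L → Together attachBag u w
  attachBag-new u∈ w∈ = zero , u∈ , w∈

-- Covering a node is written as `Together v v`, so that `minor-together` and `attachBag-old`
-- transport covered nodes and covered edges alike. Adjacent pairs in place of edges make parallel
-- copies and orientations irrelevant.
record Tw₂ (G : Graph) : Set where
  field
    tree          : Graph
    isTree        : IsTree tree
    decomposition : Decomposition tree (Node G)
    coversNodes   : ∀ v → Together decomposition v v
    coversEdges   : ∀ {u w} → Adjacent G u w → Together decomposition u w

-- Bags as lists and bags as subsets

module _ {n : ℕ} where

  fromList : List (Fin n) → Subset n
  fromList = ⋃ ∘ List.map ⁅_⁆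

  ∈-fromList⁺ : ∀ {x xs} → x ∈ xs → x Subset.∈ fromList xs
  ∈-fromList⁺ (here refl) = x∈p∪q⁺ (inj₁ (x∈⁅x⁆ _))
  ∈-fromList⁺ (there x∈)  = x∈p∪q⁺ (inj₂ (∈-fromList⁺ x∈))

  ∈-fromList⁻ : ∀ {x} xs → x Subset.∈ fromList xs → x ∈ xs
  ∈-fromList⁻ []       x∈ = contradiction x∈ ∉⊥
  ∈-fromList⁻ (y ∷ xs) x∈ with x∈p∪q⁻ ⁅ y ⁆ _ x∈
  ... | inj₁ x∈y  = here (x∈⁅y⁆⇒x≡y y x∈y)
  ... | inj₂ x∈xs = there (∈-fromList⁻ xs x∈xs)

∣p∪q∣≤∣p∣+∣q∣ : ∀ {n} (p q : Subset n) → ∣ p ∪ q ∣ ≤ ∣ p ∣ + ∣ q ∣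
∣p∪q∣≤∣p∣+∣q∣ []            []            = z≤n
∣p∪q∣≤∣p∣+∣q∣ (outside ∷ p) (outside ∷ q) = ∣p∪q∣≤∣p∣+∣q∣ p q
∣p∪q∣≤∣p∣+∣q∣ (outside ∷ p) (inside  ∷ q) =
  ℕ.≤-trans (s≤s (∣p∪q∣≤∣p∣+∣q∣ p q)) (ℕ.≤-reflexive (sym (ℕ.+-suc ∣ p ∣ ∣ q ∣)))
∣p∪q∣≤∣p∣+∣q∣ (inside  ∷ p) (outside ∷ q) = s≤s (∣p∪q∣≤∣p∣+∣q∣ p q)
∣p∪q∣≤∣p∣+∣q∣ (inside  ∷ p) (inside  ∷ q) =
  s≤s (ℕ.≤-trans (∣p∪q∣≤∣p∣+∣q∣ p q) (ℕ.+-monoʳ-≤ ∣ p ∣ (ℕ.n≤1+n ∣ q ∣)))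

-- Only an inequality, since a bag obtained by contraction may list a node twice.
∣fromList∣≤length : ∀ {n} (xs : List (Fin n)) → ∣ fromList xs ∣ ≤ length xs
∣fromList∣≤length {n} []       = ℕ.≤-reflexive (∣⊥∣≡0 n)
∣fromList∣≤length     (x ∷ xs) = ℕ.≤-trans (∣p∪q∣≤∣p∣+∣q∣ ⁅ x ⁆ (fromList xs))
  (ℕ.+-mono-≤ (ℕ.≤-reflexive (∣⁅x⁆∣≡1 x)) (∣fromList∣≤length xs))

toList : ∀ {n} → Subset n → List (Fin n)
toList []            = []
toList (inside  ∷ p) = zero ∷ List.map suc (toList p)
toList (outside ∷ p) = List.map suc (toList p)

∈-toList⁺ : ∀ {n x} {p : Subset n} → x Subset.∈ p → x ∈ toList p
∈-toList⁺ {p = inside  ∷ p} here       = here refl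
∈-toList⁺ {p = inside  ∷ p} (there x∈) = there (∈-map⁺ suc (∈-toList⁺ x∈))
∈-toList⁺ {p = outside ∷ p} (there x∈) = ∈-map⁺ suc (∈-toList⁺ x∈)

∈-toList⁻ : ∀ {n x} (p : Subset n) → x ∈ toList p → x Subset.∈ p
∈-toList⁻ (inside  ∷ p) (here refl) = here
∈-toList⁻ (inside  ∷ p) (there x∈) with ∈-map⁻ suc x∈
... | y , y∈ , refl = there (∈-toList⁻ p y∈)
∈-toList⁻ (outside ∷ p) x∈ with ∈-map⁻ suc x∈
... | y , y∈ , refl = there (∈-toList⁻ p y∈)

length-toList : ∀ {n} (p : Subset n) → length (toList p) ≡ ∣ p ∣
length-toList []            = refl
length-toList (inside  ∷ p) = cong suc (trans (length-map suc (toList p)) (length-toList p))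
length-toList (outside ∷ p) = trans (length-map suc (toList p)) (length-toList p)

⨆-lub : ∀ {n m} (f : Fin n → ℕ) → (∀ i → f i ≤ m) → foldr _⊔_ 0 f ≤ m
⨆-lub {zero}  f f≤m = z≤n
⨆-lub {suc n} f f≤m = ℕ.⊔-lub (f≤m zero) (⨆-lub (f ∘ suc) (f≤m ∘ suc))

⨆-upper : ∀ {n} (f : Fin n → ℕ) i → f i ≤ foldr _⊔_ 0 f
⨆-upper f zero    = ℕ.m≤m⊔n _ _
⨆-upper f (suc i) = ℕ.≤-trans (⨆-upper (f ∘ suc) i) (ℕ.m≤n⊔m _ _)

Tw₂⇒tw≤2 : ∀ {G} → Tw₂ G → tw[ G ]≤ 2
Tw₂⇒tw≤2 {G} t = record
  { tree          = tree
  ; isTree        = isTree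
  ; bag           = fromList ∘ bag
  ; coversNodes   = λ v → let i , v∈ , _ = coversNodes v in i , ∈-fromList⁺ v∈
  ; coversEdges   = λ e → let i , u∈ , w∈ = coversEdges (e , inj₁ refl) in
                          i , ∈-fromList⁺ u∈ , ∈-fromList⁺ w∈
  ; bagsConnected = λ v i j v∈i v∈j → Star.map
      (λ { (x , y , ab) → ∈-fromList⁺ x , ∈-fromList⁺ y , ab })
      (connected v i j (∈-fromList⁻ _ v∈i) (∈-fromList⁻ _ v∈j))
  } , ℕ.∸-monoˡ-≤ 1 (⨆-lub (∣_∣ ∘ fromList ∘ bag)
        (λ i → ℕ.≤-trans (∣fromList∣≤length (bag i)) (small i)))
  where
  open Tw₂ t
  open Decomposition decomposition hiding (Together)

tw≤2⇒Tw₂ : ∀ {G} → tw[ G ]≤ 2 → Tw₂ G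
tw≤2⇒Tw₂ {G} (D , width≤2) = record
  { tree          = tree
  ; isTree        = isTree
  ; decomposition = record
    { bag       = toList ∘ bag
    ; small     = λ i → ℕ.≤-trans (ℕ.≤-reflexive (length-toList (bag i)))
        (ℕ.≤-trans (⨆-upper (∣_∣ ∘ bag) i)
        -- `m ≤ 1 + (m ∸ 1)` holds even for `m = 0`, so the truncated subtraction in `width` does no
        -- harm.
        (ℕ.≤-trans (ℕ.m≤n+m∸n _ 1) (s≤s width≤2)))
    ; connected = λ v i j v∈i v∈j → Star.map
        (λ { (x , y , ab) → ∈-toList⁺ x , ∈-toList⁺ y , ab })
        (bagsConnected v i j (∈-toList⁻ _ v∈i) (∈-toList⁻ _ v∈j))
    }
  ; coversNodes   = λ v → let i , v∈ = coversNodes v in i , ∈-toList⁺ v∈ , ∈-toList⁺ v∈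
  ; coversEdges   = covers
  }
  where
  open TreeDecomposition D
  covers : ∀ {u w} → Adjacent G u w → ∃[ i ] (u ∈ toList (bag i) × w ∈ toList (bag i))
  covers (e , j) with coversEdges e | j
  ... | i , u∈ , w∈ | inj₁ refl = i , ∈-toList⁺ u∈ , ∈-toList⁺ w∈
  ... | i , u∈ , w∈ | inj₂ refl = i , ∈-toList⁺ w∈ , ∈-toList⁺ u∈

-- Degrees

[≟]-refl : ∀ {n} (u : Fin n) → [ u ≟ u ] ≡ 1
[≟]-refl u with u ≟ u
... | yes _  = refl
... | no u≢u = contradiction refl u≢u

[≟]-≢ : ∀ {n} {u v : Fin n} → u ≢ v → [ u ≟ v ] ≡ 0
[≟]-≢ {u = u} {v} u≢v with u ≟ v
... | yes u≡v = contradiction u≡v u≢v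
... | no _    = refl

[≟]-injective : ∀ {m n} {f : Fin m → Fin n} → Injective _≡_ _≡_ f → ∀ u v → [ f u ≟ f v ] ≡ [ u ≟ v ]
[≟]-injective {f = f} inj u v with u ≟ v
... | yes refl = [≟]-refl (f u)
... | no u≢v   = [≟]-≢ (u≢v ∘ inj)

sum-++ : ∀ {m n} (f : Vector ℕ m) (g : Vector ℕ n) → sum (f ++ g) ≡ sum f + sum g
sum-++ {zero}  f g = refl
sum-++ {suc m} f g = trans (cong (f zero +_) (trans (sum-cong-≗ tail) (sum-++ (f ∘ suc) g)))
                           (sym (ℕ.+-assoc (f zero) _ _))
  where
  tail : ∀ i → (f ++ g) (suc i) ≡ ((f ∘ suc) ++ g) i
  tail i with splitAt m i
  ... | inj₁ _ = refl
  ... | inj₂ _ = refl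

∘-++ : ∀ {A B : Set} (h : A → B) {m n} (f : Vector A m) (g : Vector A n) i →
       h ((f ++ g) i) ≡ ((h ∘ f) ++ (h ∘ g)) i
∘-++ h {m} f g i with splitAt m i
... | inj₁ _ = refl
... | inj₂ _ = refl

sum-updateAt : ∀ {n} (f : Vector ℕ n) i c → sum (updateAt f i (const c)) + f i ≡ c + sum f
sum-updateAt f zero c = trans (ℕ.+-assoc c _ _) (cong (c +_) (ℕ.+-comm _ (f zero)))
sum-updateAt {suc n} f (suc i) c =
  trans (ℕ.+-assoc (f zero) _ _) (trans (cong (f zero +_) (sum-updateAt (f ∘ suc) i c)) (swap₃ (f zero) c _))
  where
  swap₃ : ∀ a b d → a + (b + d) ≡ b + (a + d)
  swap₃ = solve-∀

-- An entry is set to 0 once it has been counted; the remaining list does not contain it and so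
-- keeps its values.
length≤sum : ∀ {n} {xs : List (Fin n)} (f : Vector ℕ n) → Unique xs → All (λ i → 1 ≤ f i) xs →
             length xs ≤ sum f
length≤sum f []          []          = z≤n
length≤sum {xs = x ∷ xs} f (x∉ ∷ uniq) (1≤ ∷ all) =
  ℕ.≤-trans (ℕ.≤-reflexive (ℕ.+-comm 1 (length xs)))
  (ℕ.≤-trans (ℕ.+-mono-≤ (length≤sum (updateAt f x (const 0)) uniq (zip x∉ all)) 1≤)
             (ℕ.≤-reflexive (sum-updateAt f x 0)))
  where
  zip : ∀ {ys} → All (x ≢_) ys → All (λ i → 1 ≤ f i) ys → All (λ i → 1 ≤ updateAt f x (const 0) i) ys
  zip []       []       = []
  zip (p ∷ ps) (q ∷ qs) = subst (1 ≤_) (sym (updateAt-minimal _ x f (≢-sym p))) q ∷ zip ps qs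

-- The contribution of one edge: `deg G v` is `sum (share v ∘ ends)` by definition.
share : ∀ {n} → Fin n → Fin n × Fin n → ℕ
share v (u , w) = [ u ≟ v ] + [ w ≟ v ]

share-∼ : ∀ {n} {v : Fin n} {p q} → p ∼ q → share v p ≡ share v q
share-∼             (inj₁ refl) = refl
share-∼ {q = u , w} (inj₂ refl) = ℕ.+-comm [ w ≟ _ ] [ u ≟ _ ]

1≤shareˡ : ∀ {n} (v w : Fin n) → 1 ≤ share v (v , w)
1≤shareˡ v w rewrite [≟]-refl v = s≤s z≤n

joins⇒1≤share : ∀ G {e v w} → Joins G e v w → 1 ≤ share v (Graph.ends G e)
joins⇒1≤share G {v = v} {w} j = subst (1 ≤_) (sym (share-∼ j)) (1≤shareˡ v w)

module _ {G H : Graph} (G≅H : G ≅ H) where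

  open _≅_ G≅H
  open Inverse

  ≅-injective : Injective _≡_ _≡_ (to nodes)
  ≅-injective {u} {w} eq =
    trans (sym (strictlyInverseʳ nodes u)) (trans (cong (from nodes) eq) (strictlyInverseʳ nodes w))

  ≅-adjacent : ∀ {u w} → Adjacent G u w → Adjacent H (to nodes u) (to nodes w)
  ≅-adjacent (e , j) = to edges e , ∼-trans (preserves e) (∼-map (to nodes) j)

  deg-≅ : ∀ v → deg H (to nodes v) ≡ deg G v
  deg-≅ v = trans (sum-permute (share (to nodes v) ∘ Graph.ends H) edges) (sum-cong-≗ λ e →
    trans (share-∼ (preserves e))
          (cong₂ _+_ ([≟]-injective ≅-injective _ v) ([≟]-injective ≅-injective _ v)))

  Tw₂-≅ : Tw₂ H → Tw₂ G
  Tw₂-≅ t = record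
    { tree          = tree
    ; isTree        = isTree
    ; decomposition = image
    ; coversNodes   = λ v → moved (coversNodes (to nodes v))
    ; coversEdges   = λ a → moved (coversEdges (≅-adjacent a))
    }
    where
    open Tw₂ t
    fibres : ∀ {u w} → from nodes u ≡ from nodes w → Star _ u w
    fibres {u} {w} eq
      with refl ← trans (sym (strictlyInverseˡ nodes u)) (trans (cong (to nodes) eq) (strictlyInverseˡ nodes w)) = ε
    image : Decomposition tree (Node G)
    image = minor decomposition (from nodes) fibres
    moved : ∀ {u w} → Together decomposition (to nodes u) (to nodes w) → Together image u w
    moved tog = subst₂ (Decomposition.Together image) (strictlyInverseʳ nodes _) (strictlyInverseʳ nodes _)
                       (minor-together decomposition (from nodes) fibres tog)

subdivide-ends-at : ∀ G e → Graph.ends (subdivide G e) (suc e) ≡ (suc (proj₁ (Graph.ends G e)) , zero)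
subdivide-ends-at G e = updateAt-updates e (map suc suc ∘ Graph.ends G)

subdivide-ends-other : ∀ G {e i} → i ≢ e → Graph.ends (subdivide G e) (suc i) ≡ map suc suc (Graph.ends G i)
subdivide-ends-other G {e} {i} i≢e = updateAt-minimal i e (map suc suc ∘ Graph.ends G) i≢e

module _ (G : Graph) (e : Edge G) where

  open Graph G
  private
    u = proj₁ (ends e)
    w = proj₂ (ends e)

  private
    sum-subdivide : ∀ x c (g : Vector ℕ #edges) → (∀ i → share x (map suc suc (ends i)) ≡ g i) →
                    share x (suc u , zero) ≡ c →
                    sum (share x ∘ updateAt (map suc suc ∘ ends) e (const (suc u , zero)))
                    ≡ sum (updateAt g e (const c))
    sum-subdivide x c g g≗ refl = sum-cong-≗ pointwise
      where
      pointwise : ∀ i → share x (updateAt (map suc suc ∘ ends) e (const (suc u , zero)) i) ≡ updateAt g e (const c) i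
      pointwise i with i ≟ e
      ... | yes refl = trans (cong (share x) (subdivide-ends-at G e)) (sym (updateAt-updates e g))
      ... | no i≢e   = trans (cong (share x) (subdivide-ends-other G i≢e))
                             (trans (g≗ i) (sym (updateAt-minimal i e g i≢e)))

  -- The shortened edge keeps its end `u` and loses `w`, whose contribution the new edge restores.
  deg-subdivide-old : ∀ v → deg (subdivide G e) (suc v) ≡ deg G v
  deg-subdivide-old v = begin
    [ w ≟ v ] + sum (share (suc v) ∘ updateAt (map suc suc ∘ ends) e (const (suc u , zero)))
      ≡⟨ cong ([ w ≟ v ] +_) (sum-subdivide (suc v) [ u ≟ v ] (share v ∘ ends) (λ _ → refl) (ℕ.+-identityʳ _)) ⟩
    [ w ≟ v ] + sum (updateAt (share v ∘ ends) e (const [ u ≟ v ]))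
      ≡⟨ ℕ.+-cancelˡ-≡ [ u ≟ v ] _ _ (trans (rotate [ u ≟ v ] [ w ≟ v ] _)
                                           (sum-updateAt (share v ∘ ends) e [ u ≟ v ])) ⟩
    deg G v ∎
    where
    open ≡-Reasoning
    rotate : ∀ a b c → a + (b + c) ≡ c + (a + b)
    rotate = solve-∀

  deg-subdivide-new : deg (subdivide G e) zero ≡ 2
  deg-subdivide-new = cong suc (trans
    (sum-subdivide zero 1 (const 0) (λ _ → refl) refl)
    (trans (sym (ℕ.+-identityʳ _)) (trans (sum-updateAt (const 0) e 1) (cong suc (sum-replicate-zero #edges)))))

visits : ∀ {n k} → (Fin k → Fin n) → Fin n → ℕ
visits N v = sum (λ j → [ N j ≟ v ])

visits-≢ : ∀ {n k} {N : Fin k → Fin n} {v} → (∀ j → N j ≢ v) → visits N v ≡ 0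
visits-≢ {k = k} N≢v = trans (sum-cong-≗ ([≟]-≢ ∘ N≢v)) (sum-replicate-zero k)

visits-id : ∀ {k} (i : Fin k) → visits id i ≡ 1
visits-id {suc k} zero = cong suc (visits-≢ {N = Fin.suc {k}} {zero} λ j ())
visits-id (suc i) = visits-id i

visits-injective : ∀ {n k} {N : Fin k → Fin n} → Injective _≡_ _≡_ N → ∀ i → visits N (N i) ≡ 1
visits-injective inj i = trans (sum-cong-≗ λ j → [≟]-injective inj j i) (visits-id i)

module _ (G : Graph) {k : ℕ} (P : Path G k) where

  open Graph G
  open _↪ᴳ_ P

  -- The new edges form a cycle through the nodes of P, up to the choice of edges.
  deg-addDoubleEar : ∀ v → deg (addDoubleEar G P) v ≡ deg G v + 2 * visits node v
  deg-addDoubleEar v = begin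
    sum (share v ∘ (ends ++ new))                   ≡⟨ sum-cong-≗ (∘-++ (share v) ends new) ⟩
    sum ((share v ∘ ends) ++ (share v ∘ new))       ≡⟨ sum-++ (share v ∘ ends) (share v ∘ new) ⟩
    deg G v + (a zero + a (fromℕ k) + sum (share v ∘ ends ∘ edge))
      ≡⟨ cong (λ s → deg G v + (a zero + a (fromℕ k) + s))
              (trans (sum-cong-≗ (λ i → share-∼ (preserves i))) (∑-distrib-+ (a ∘ inject₁) (a ∘ suc))) ⟩
    deg G v + (a zero + a (fromℕ k) + (sum (a ∘ inject₁) + sum (a ∘ suc)))
      ≡⟨ cong (deg G v +_) (regroup (a zero) (a (fromℕ k)) (sum (a ∘ inject₁)) (sum (a ∘ suc))) ⟩
    deg G v + ((sum (a ∘ inject₁) + a (fromℕ k)) + (sum a + 0))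
      ≡⟨ cong (λ s → deg G v + (s + (sum a + 0))) (sym (sum-init-last a)) ⟩
    deg G v + 2 * visits node v                     ∎
    where
    open ≡-Reasoning
    new = (node zero , node (fromℕ k)) ∷ᶠ (ends ∘ edge)
    a : Fin (suc k) → ℕ
    a j = [ node j ≟ v ]
    regroup : ∀ p q r s → p + q + (r + s) ≡ (r + q) + ((p + s) + 0)
    regroup = solve-∀

  deg-addDoubleEar-on : ∀ i → deg (addDoubleEar G P) (node i) ≡ deg G (node i) + 2
  deg-addDoubleEar-on i = trans (deg-addDoubleEar (node i))
    (cong (λ n → deg G (node i) + 2 * n) (visits-injective node-injective i))

  deg-addDoubleEar-off : ∀ {v} → (∀ i → node i ≢ v) → deg (addDoubleEar G P) v ≡ deg G v
  deg-addDoubleEar-off {v} off = trans (deg-addDoubleEar v)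
    (trans (cong (λ n → deg G v + 2 * n) (visits-≢ off)) (ℕ.+-identityʳ _))

Deg24 : Graph → Set
Deg24 G = ∀ v → deg G v ≡ 2 ⊎ deg G v ≡ 4

Deg24-≅ : ∀ {G H} → G ≅ H → Deg24 H → Deg24 G
Deg24-≅ G≅H d v = Sum.map (trans (sym (deg-≅ G≅H v))) (trans (sym (deg-≅ G≅H v))) (d _)

Deg24-subdivide : ∀ G e → Deg24 G → Deg24 (subdivide G e)
Deg24-subdivide G e d zero    = inj₁ (deg-subdivide-new G e)
Deg24-subdivide G e d (suc v) = Sum.map (trans (deg-subdivide-old G e v)) (trans (deg-subdivide-old G e v)) (d v)

Deg24-addDoubleEar : ∀ G {k} (P : Path G k) →
                     (∀ i → deg G (_↪ᴳ_.node P i) ≡ 2) → Deg24 G → Deg24 (addDoubleEar G P)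
Deg24-addDoubleEar G P deg≡2 d v with any? (λ i → _↪ᴳ_.node P i ≟ v)
... | yes (i , refl) = inj₂ (trans (deg-addDoubleEar-on G P i) (cong (_+ 2) (deg≡2 i)))
... | no off         = Sum.map (trans eq) (trans eq) (d v)
  where eq = deg-addDoubleEar-off G P (λ i eq → off (i , eq))

-- The second alternative records only that both nodes lie among three given ones: these form the
-- bag that `Tw₂-subdivide` attaches.
subdivide-edge : ∀ G e → let u , w = Graph.ends G e in
                 ∀ {x y} → Adjacent (subdivide G e) x y →
                 (∃₂ λ a b → Adjacent G a b × suc a ≡ x × suc b ≡ y)
                 ⊎ (x ∈ (zero ∷ suc u ∷ suc w ∷ []) × y ∈ (zero ∷ suc u ∷ suc w ∷ []))
subdivide-edge G e (zero , inj₁ refl) = inj₂ (here refl , there (there (here refl)))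
subdivide-edge G e (zero , inj₂ refl) = inj₂ (there (there (here refl)) , here refl)
subdivide-edge G e (suc i , j) with i ≟ e
... | yes refl with subst (_∼ _) (subdivide-ends-at G e) j
...   | inj₁ refl = inj₂ (there (here refl) , here refl)
...   | inj₂ refl = inj₂ (here refl , there (here refl))
subdivide-edge G e (suc i , j) | no i≢e with subst (_∼ _) (subdivide-ends-other G i≢e) j
...   | inj₁ refl = inj₁ (_ , _ , (i , inj₁ refl) , refl , refl)
...   | inj₂ refl = inj₁ (_ , _ , (i , inj₂ refl) , refl , refl)

-- Some bag contains both ends of `e`; next to it there is room for a bag with these ends and the
-- new node, three nodes in all.
Tw₂-subdivide : ∀ G e → Tw₂ G → Tw₂ (subdivide G e)
Tw₂-subdivide G e t with Tw₂.coversEdges t (e , inj₁ refl)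
... | i , u∈i , w∈i = record
  { tree          = attach tree i
  ; isTree        = attach-isTree isTree
  ; decomposition = D
  ; coversNodes   = λ { zero    → attachBag-new shifted i bag small near (here refl) (here refl)
                      ; (suc v) → attachBag-old shifted i bag small near (lifted (coversNodes v)) }
  ; coversEdges   = λ a → covers (subdivide-edge G e a)
  }
  where
  open Tw₂ t
  fibres : ∀ {u w} → suc u ≡ suc w → Star _ u w
  fibres refl = ε
  shifted : Decomposition tree (Node (subdivide G e))
  shifted = minor decomposition suc fibres
  lifted : ∀ {u w} → Decomposition.Together decomposition u w → Decomposition.Together shifted (suc u) (suc w)
  lifted = minor-together decomposition suc fibres
  bag : List (Node (subdivide G e))
  bag = zero ∷ suc (proj₁ (Graph.ends G e)) ∷ suc (proj₂ (Graph.ends G e)) ∷ []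
  small : length bag ≤ 3
  small = s≤s (s≤s (s≤s z≤n))
  near : ∀ {v} → v ∈ bag → v ∈ Decomposition.bag shifted i ⊎ (∀ j → v ∉ Decomposition.bag shifted j)
  near (here refl)                 = inj₂ λ j 0∈ → notZero (Decomposition.bag decomposition j) 0∈
    where
    notZero : ∀ {n} (xs : List (Fin n)) → zero ∉ List.map Fin.suc xs
    notZero (x ∷ xs) (there 0∈) = notZero xs 0∈
  near (there (here refl))         = inj₁ (∈-map⁺ suc u∈i)
  near (there (there (here refl))) = inj₁ (∈-map⁺ suc w∈i)
  D : Decomposition (attach tree i) (Node (subdivide G e))
  D = attachBag shifted i bag small near
  covers : ∀ {x y} → (∃₂ λ a b → Adjacent G a b × suc a ≡ x × suc b ≡ y) ⊎ (x ∈ bag × y ∈ bag) →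
           Decomposition.Together D x y
  covers (inj₁ (_ , _ , ab , refl , refl)) = attachBag-old shifted i bag small near (lifted (coversEdges ab))
  covers (inj₂ (x∈ , y∈))                  = attachBag-new shifted i bag small near x∈ y∈

-- The steps of a double ear decomposition preserve width and degrees

-- A triangulated fan with hub `c` over the path `g`. Only the spoke to `g zero` is recorded: with
-- `c` as the first node of a path and `g` as the rest, it is the first edge of that path.
record Fan {T : Graph} {V : Set} (D : Decomposition T V) (c : V) {j : ℕ} (g : Fin (suc j) → V) : Set where
  field
    tree          : Graph
    isTree        : IsTree tree
    decomposition : Decomposition tree V
    keeps         : ∀ {u w} → Together D u w → Together decomposition u w
    spoke         : Together decomposition c (g zero)
    rim           : ∀ i → Together decomposition (g (inject₁ i)) (g (suc i))

-- Built from the far end of `g`. A bag with `c` and the last two nodes of `g` is attached where `c`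
-- and the last node meet; now `c` meets the last but one, and the shortened path is treated in the
-- same way.
fan : ∀ {T V} → IsTree T → (D : Decomposition T V) (c : V) {j : ℕ} (g : Fin (suc j) → V) →
      Injective _≡_ _≡_ g → Together D c (g (fromℕ j)) →
      (∀ i a → g (inject₁ i) ∉ Decomposition.bag D a) → Fan D c g
fan isTree D c {zero} g inj spoke new = record
  { isTree = isTree ; decomposition = D ; keeps = id ; spoke = spoke ; rim = λ () }
fan {T} {V} isTree D c {suc j} g inj (a , c∈ , g∈) new = record
  { isTree        = F.isTree
  ; decomposition = F.decomposition
  ; keeps         = F.keeps ∘ attachBag-old D a bag small near
  ; spoke         = F.spoke
  ; rim           = rim
  }
  where
  bag : List V
  bag = c ∷ g (inject₁ (fromℕ j)) ∷ g (fromℕ (suc j)) ∷ []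
  small : length bag ≤ 3
  small = s≤s (s≤s (s≤s z≤n))
  near : ∀ {v} → v ∈ bag → v ∈ Decomposition.bag D a ⊎ (∀ b → v ∉ Decomposition.bag D b)
  near (here refl)                 = inj₁ c∈
  near (there (here refl))         = inj₂ (new (fromℕ j))
  near (there (there (here refl))) = inj₁ g∈
  new′ : ∀ i b → g (inject₁ (inject₁ i)) ∉ Decomposition.bag (attachBag D a bag small near) b
  new′ i zero    (here eq)                 = new (inject₁ i) a (subst (_∈ _) (sym eq) c∈)
  new′ i zero    (there (here eq))         = fromℕ≢inject₁ (sym (inject₁-injective (inj eq)))
  new′ i zero    (there (there (here eq))) = fromℕ≢inject₁ (sym (inj eq))
  new′ i (suc b) x∈                        = new (inject₁ i) b x∈
  module F = Fan (fan (attach-isTree isTree) (attachBag D a bag small near) c (g ∘ inject₁)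
                      (inject₁-injective ∘ inj) (attachBag-new D a bag small near (here refl) (there (here refl)))
                      new′)
  rim : ∀ i → Together F.decomposition (g (inject₁ i)) (g (suc i))
  rim i with view i
  ... | ‵fromℕ     = F.keeps (attachBag-new D a bag small near (there (here refl)) (there (there (here refl))))
  ... | ‵inject₁ i = F.rim i

addDoubleEar-edge : ∀ G {k} (P : Path G k) {x y} → Adjacent (addDoubleEar G P) x y →
                    Adjacent G x y ⊎ (_↪ᴳ_.node P zero , _↪ᴳ_.node P (fromℕ k)) ∼ (x , y)
addDoubleEar-edge G P (e , j) with splitAt (Graph.#edges G) e
... | inj₁ e′      = inj₁ (e′ , j)
... | inj₂ zero    = inj₂ j
... | inj₂ (suc i) = inj₁ (_↪ᴳ_.edge P i , j)

module _ (G : Graph) {k : ℕ} (P : Path G (suc k)) (deg≡2 : ∀ i → deg G (_↪ᴳ_.node P i) ≡ 2) (t : Tw₂ G) where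

  open _↪ᴳ_ P
  open Tw₂ t

  private
    end : Node G
    end = node (fromℕ (suc k))

    onPath? : ∀ x → Dec (∃[ j ] node (suc j) ≡ x)
    onPath? x = any? λ j → node (suc j) ≟ x

    -- contracts the path, except for its first edge
    f : Node G → Node G
    f x with onPath? x
    ... | yes _ = end
    ... | no _  = x

    f-on : ∀ j → f (node (suc j)) ≡ end
    f-on j with onPath? (node (suc j))
    ... | yes _ = refl
    ... | no ¬p = contradiction (j , refl) ¬p

    f-first : f (node zero) ≡ node zero
    f-first with onPath? (node zero)
    ... | yes (j , eq) = contradiction (node-injective eq) λ ()
    ... | no _         = refl

    Interior : Node G → Set
    Interior x = ∃[ i ] node (suc (inject₁ i)) ≡ x

    f-¬interior : ∀ x → ¬ Interior x → f x ≡ x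
    f-¬interior x ¬int with onPath? x
    ... | no _ = refl
    ... | yes (j , eq) with view j
    ...   | ‵fromℕ     = eq
    ...   | ‵inject₁ i = contradiction (i , eq) ¬int

    f-misses : ∀ x i → f x ≢ node (suc (inject₁ i))
    f-misses x i with onPath? x
    ... | yes _ = λ eq → fromℕ≢inject₁ (suc-injective (node-injective eq))
    ... | no ¬p = λ eq → ¬p (inject₁ i , sym eq)

    Step′ : Node G → Node G → Set
    Step′ a b = f a ≡ f b × Together decomposition a b

    along : ∀ i → Together decomposition (node (inject₁ i)) (node (suc i))
    along i = coversEdges (edge i , preserves i)

    fromFirst : ∀ j → Star Step′ (node (suc zero)) (node (suc j))
    fromFirst = chain (node ∘ suc) λ i → trans (f-on (inject₁ i)) (sym (f-on (suc i))) , along (suc i)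

    fibres : ∀ {u w} → f u ≡ f w → Star Step′ u w
    fibres {u} {w} eq with onPath? u | onPath? w
    ... | yes (i , refl) | yes (j , refl) =
      Star.reverse (λ { (p , q) → sym p , Decomposition.together-sym decomposition q }) (fromFirst i) ◅◅ fromFirst j
    ... | yes _          | no ¬w          = contradiction (fromℕ k , eq) ¬w
    ... | no ¬u          | yes _          = contradiction (fromℕ k , sym eq) ¬u
    ... | no _           | no _           with refl ← eq = ε

    contracted : Decomposition tree (Node G)
    contracted = minor decomposition f fibres

    contracted-together : ∀ {u w} → Together decomposition u w → Together contracted (f u) (f w)
    contracted-together = minor-together decomposition f fibres

    -- The contraction spares the first edge of the path for this purpose: its image joins the ends
    -- of the chord.
    first-end : Together contracted (node zero) end
    first-end = subst₂ (Together contracted) f-first (f-on zero) (contracted-together (along zero))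

    -- The contraction clears the interior nodes from all bags, so that `fan` may put them back on a
    -- new branch of the tree.
    new : ∀ i a → node (suc (inject₁ i)) ∉ Decomposition.bag contracted a
    new i a x∈ with ∈-map⁻ f x∈
    ... | y , _ , eq = f-misses y i (sym eq)

    module F = Fan (fan isTree contracted (node zero) (node ∘ suc) (suc-injective ∘ node-injective) first-end new)

    -- Two path edges already exhaust the degree 2 of an interior node. Hence the fan, which covers
    -- the path, covers every edge that the contraction destroys.
    onlyPathEdges : ∀ {i y e} → Joins G e (node (suc (inject₁ i))) y → ∃[ j ] edge j ≡ e
    onlyPathEdges {i} {y} {e} joins with any? (λ j → edge j ≟ e)
    ... | yes p = p
    ... | no ¬p = contradiction (subst (3 ≤_) (deg≡2 (suc (inject₁ i))) (length≤sum _ distinct incident))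
                                λ { (s≤s (s≤s ())) }
      where
      v : Node G
      v = node (suc (inject₁ i))
      distinct : Unique (edge (inject₁ i) ∷ edge (suc i) ∷ e ∷ [])
      distinct = (inject₁≢suc i ∘ edge-injective ∷ (λ eq → ¬p (_ , eq)) ∷ []) ∷ ((λ eq → ¬p (_ , eq)) ∷ []) ∷ [] ∷ []
      incident : All (λ e → 1 ≤ share v (Graph.ends G e)) (edge (inject₁ i) ∷ edge (suc i) ∷ e ∷ [])
      incident = joins⇒1≤share G (∼-swap (preserves (inject₁ i))) ∷ joins⇒1≤share G (preserves (suc i))
                 ∷ joins⇒1≤share G joins ∷ []

    onPathEdge : ∀ j → Together F.decomposition (node (inject₁ j)) (node (suc j))
    onPathEdge zero    = F.spoke
    onPathEdge (suc j) = F.rim j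

    open Decomposition F.decomposition using (together-sym)

    interior-covered : ∀ {x y} → Interior x → Adjacent G x y → Together F.decomposition x y
    interior-covered (i , refl) (e , joins) with onlyPathEdges joins
    ... | j , refl with ∼-trans (∼-sym (preserves j)) joins
    ...   | inj₁ eq = subst₂ (Together F.decomposition) (cong proj₁ eq) (cong proj₂ eq) (onPathEdge j)
    ...   | inj₂ eq = subst₂ (Together F.decomposition) (cong proj₂ eq) (cong proj₁ eq) (together-sym (onPathEdge j))

    interior? : ∀ x → Dec (Interior x)
    interior? x = any? λ i → node (suc (inject₁ i)) ≟ x

    kept : ∀ {x y} → ¬ Interior x → ¬ Interior y → Together decomposition x y → Together F.decomposition x y
    kept ¬x ¬y tog = F.keeps
      (subst₂ (Together contracted) (f-¬interior _ ¬x) (f-¬interior _ ¬y) (contracted-together tog))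

    edge-covered : ∀ {x y} → Adjacent G x y → Together F.decomposition x y
    edge-covered {x} {y} a with interior? x | interior? y
    ... | yes p | _     = interior-covered p a
    ... | no _  | yes q = together-sym (interior-covered q (adjacent-sym G a))
    ... | no ¬p | no ¬q = kept ¬p ¬q (coversEdges a)

    node-covered : ∀ x → Together F.decomposition x x
    node-covered x with interior? x
    ... | yes (i , refl) = let a , x∈ , _ = interior-covered (i , refl) (edge (suc i) , preserves (suc i)) in
                           a , x∈ , x∈
    ... | no ¬p          = kept ¬p ¬p (coversNodes x)

  Tw₂-addLongEar : Tw₂ (addDoubleEar G P)
  Tw₂-addLongEar = record
    { tree          = F.tree
    ; isTree        = F.isTree
    ; decomposition = F.decomposition
    ; coversNodes   = node-covered
    ; coversEdges   = covers ∘ addDoubleEar-edge G P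
    }
    where
    covers : ∀ {x y} → Adjacent G x y ⊎ (node zero , end) ∼ (x , y) → Together F.decomposition x y
    covers (inj₁ a)           = edge-covered a
    covers (inj₂ (inj₁ refl)) = F.keeps first-end
    covers (inj₂ (inj₂ refl)) = together-sym (F.keeps first-end)

Tw₂-addDoubleEar : ∀ G {k} (P : Path G k) → (∀ i → deg G (_↪ᴳ_.node P i) ≡ 2) → Tw₂ G → Tw₂ (addDoubleEar G P)
Tw₂-addDoubleEar G {suc k} P deg≡2 t = Tw₂-addLongEar G P deg≡2 t
Tw₂-addDoubleEar G {zero}  P deg≡2 t = record
  { isTree        = isTree
  ; decomposition = decomposition
  ; coversNodes   = coversNodes
  ; coversEdges   = covers ∘ addDoubleEar-edge G P
  }
  where
  open Tw₂ t
  open _↪ᴳ_ P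
  covers : ∀ {x y} → Adjacent G x y ⊎ (node zero , node zero) ∼ (x , y) → Together decomposition x y
  covers (inj₁ a)           = coversEdges a
  covers (inj₂ (inj₁ refl)) = coversNodes _
  covers (inj₂ (inj₂ refl)) = coversNodes _

singleNode : Graph
singleNode = record { #nodes = 1 ; #edges = 0 ; ends = λ () }

singleNode-isTree : IsTree singleNode
singleNode-isTree = record { someNode = zero ; reachable = λ { zero zero → ε } }
                  , λ k C → contradiction (_↪ᴳ_.edge C zero) λ ()

Tw₂-loop : Tw₂ (cycleGraph 0)
Tw₂-loop = record
  { isTree        = singleNode-isTree
  ; decomposition = record
    { bag       = λ _ → zero ∷ []
    ; small     = λ _ → s≤s z≤n
    ; connected = λ { v zero zero _ _ → ε }
    }
  ; coversNodes   = λ { zero → together }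
  ; coversEdges   = λ { {zero} {zero} _ → together }
  }
  where
  together : ∃[ i ] (zero ∈ _ × zero ∈ _)
  together = zero , here refl , here refl

-- Reduces all cycles to the loop. Subdividing the closing edge puts the new node `zero` in front of
-- the path, so that the nodes need no renaming; the closing edge and the first edge of the path
-- trade places.
cycle-subdivide : ∀ k → cycleGraph (suc k) ≅ subdivide (cycleGraph k) zero
cycle-subdivide k = record
  { nodes     = ↔-refl
  ; edges     = mk↔ₛ′ exchange exchange involutive involutive
  ; preserves = λ { zero          → inj₁ refl
                  ; (suc zero)    → inj₁ refl
                  ; (suc (suc i)) → inj₁ refl }
  }
  where
  exchange : ∀ {n} → Fin (suc (suc n)) → Fin (suc (suc n))
  exchange zero          = suc zero
  exchange (suc zero)    = zero
  exchange (suc (suc i)) = suc (suc i)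
  involutive : ∀ {n} (i : Fin (suc (suc n))) → exchange (exchange i) ≡ i
  involutive zero          = refl
  involutive (suc zero)    = refl
  involutive (suc (suc i)) = refl

Admissible : Graph → Set
Admissible G = Tw₂ G × Deg24 G

admissible-≅ : ∀ {G H} → G ≅ H → Admissible H → Admissible G
admissible-≅ G≅H (t , d) = Tw₂-≅ G≅H t , Deg24-≅ G≅H d

admissible-subdivide : ∀ G e → Admissible G → Admissible (subdivide G e)
admissible-subdivide G e (t , d) = Tw₂-subdivide G e t , Deg24-subdivide G e d

admissible-cycle : ∀ k → Admissible (cycleGraph k)
admissible-cycle zero    = Tw₂-loop , λ { zero → inj₁ refl }
admissible-cycle (suc k) =
  admissible-≅ (cycle-subdivide k) (admissible-subdivide (cycleGraph k) zero (admissible-cycle k))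

admissible-step : ∀ {G H} → Step G H → Admissible G → Admissible H
admissible-step {G} (doubleEarStep P deg≡2 H≅) (t , d) =
  admissible-≅ H≅ (Tw₂-addDoubleEar G P deg≡2 t , Deg24-addDoubleEar G P deg≡2 d)
admissible-step {G} (subdivisionStep e H≅) s = admissible-≅ H≅ (admissible-subdivide G e s)

decomposable⇒admissible : ∀ {G} → DoubleEarDecomposable G → Admissible G
decomposable⇒admissible (G₀ , (k , G₀≅) , steps) = along steps (admissible-≅ G₀≅ (admissible-cycle k))
  where
  along : ∀ {G H} → DoubleEarDecomposition G H → Admissible G → Admissible H
  along ε          = id
  along (s ◅ rest) = along rest ∘ admissible-step s

-- Walks, and the growth of a tree

lookup-injective : ∀ {A : Set} {xs : List A} → Unique xs → Injective _≡_ _≡_ (lookup xs)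
lookup-injective (_  ∷ _)  {zero}  {zero}  _  = refl
lookup-injective (x∉ ∷ _)  {zero}  {suc j} eq = contradiction eq (All.lookup x∉ (∈-lookup j))
lookup-injective (x∉ ∷ _)  {suc i} {zero}  eq = contradiction (sym eq) (All.lookup x∉ (∈-lookup i))
lookup-injective (_  ∷ uq) {suc i} {suc j} eq = cong suc (lookup-injective uq eq)

-- The list consists of the nodes visited after the first one.
infixr 5 _∷_
data Walk {V : Set} (R : V → V → Set) : V → V → List V → Set where
  []  : ∀ {x} → Walk R x x []
  _∷_ : ∀ {x y z ys} → R x y → Walk R y z ys → Walk R x z (y ∷ ys)

module _ {V : Set} {R : V → V → Set} where

  walk-end : ∀ {x z ys} → Walk R x z ys → lookup (x ∷ ys) (fromℕ (length ys)) ≡ z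
  walk-end []      = refl
  walk-end (_ ∷ w) = walk-end w

  walk-step : ∀ {x z ys} → Walk R x z ys → ∀ i → R (lookup (x ∷ ys) (inject₁ i)) (lookup ys i)
  walk-step (r ∷ _) zero    = r
  walk-step (_ ∷ w) (suc i) = walk-step w i

  walk-snoc : ∀ {x y z ys} → Walk R x y ys → R y z → Walk R x z (ys ∷ʳ z)
  walk-snoc []      r = r ∷ []
  walk-snoc (q ∷ w) r = q ∷ walk-snoc w r

-- The reversed orientation would make `i` both one more and one less than `j`.
consecutive-injective : ∀ {k} {i j : Fin k} → (inject₁ i , suc i) ∼ (inject₁ j , suc j) → i ≡ j
consecutive-injective (inj₁ eq) = suc-injective (cong proj₂ eq)
consecutive-injective (inj₂ eq) = contradiction (cong proj₁ eq , cong proj₂ eq) λ (p , q) → reversed p q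
  where
  reversed : ∀ {k} {i j : Fin k} → inject₁ i ≡ suc j → suc i ≢ inject₁ j
  reversed {i = suc i} {zero}  _ ()
  reversed {i = suc i} {suc j} p q = reversed (suc-injective p) (suc-injective q)

-- The origin of the condition `k ≢ 1` below: only on a path with a single edge can a chord be
-- confused with an edge of the path.
ends-consecutive : ∀ {k} {i : Fin k} → (zero , fromℕ k) ∼ (inject₁ i , suc i) → k ≡ 1
ends-consecutive {suc zero}    {zero} _         = refl
ends-consecutive {suc (suc k)} {zero} (inj₁ ())
ends-consecutive {suc (suc k)} {zero} (inj₂ ())

module _ (G : Graph) {k : ℕ} {N : Fin (suc k) → Node G} (N-injective : Injective _≡_ _≡_ N) where

  consecutiveEdges-injective : ∀ {e e′ : Edge G} {i j} → Joins G e (N (inject₁ i)) (N (suc i)) →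
                               Joins G e′ (N (inject₁ j)) (N (suc j)) → e ≡ e′ → i ≡ j
  consecutiveEdges-injective p q refl = consecutive-injective (∼-unmap N-injective (∼-trans (∼-sym p) q))

  closingEdge : ∀ {e e′ : Edge G} {i} → k ≢ 1 → Joins G e (N zero) (N (fromℕ k)) →
                Joins G e′ (N (inject₁ i)) (N (suc i)) → e ≢ e′
  closingEdge k≢1 p q refl = k≢1 (ends-consecutive (∼-unmap N-injective (∼-trans (∼-sym p) q)))

  -- Edges at different positions of the path have different pairs of ends, which makes any choice
  -- of edges injective.
  toPath : (pick : Fin k → Edge G) → (∀ i → Joins G (pick i) (N (inject₁ i)) (N (suc i))) → Path G k
  toPath pick joins = record
    { hom            = record { node = N ; edge = pick ; preserves = joins }
    ; node-injective = N-injective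
    ; edge-injective = λ {i} {j} → consecutiveEdges-injective (joins i) (joins j)
    }

-- For `k = 1` the closing edge might be the edge of the path itself; for `k = 0` it is a loop,
-- which is a cycle.
closeCycle : ∀ G {k} (P : Path G k) → k ≢ 1 →
             Adjacent G (_↪ᴳ_.node P zero) (_↪ᴳ_.node P (fromℕ k)) → cycleGraph k ↪ᴳ G
closeCycle G P k≢1 (e , joins) = record
  { hom            = record
    { node      = node
    ; edge      = e ∷ᶠ edge
    ; preserves = λ { zero → ∼-swap joins ; (suc i) → preserves i }
    }
  ; node-injective = node-injective
  ; edge-injective = injective
  }
  where
  open _↪ᴳ_ P
  injective : Injective _≡_ _≡_ (e ∷ᶠ edge)
  injective {zero}  {zero}  _  = refl
  injective {zero}  {suc j} eq = contradiction eq (closingEdge G node-injective k≢1 joins (preserves j))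
  injective {suc i} {zero}  eq = contradiction (sym eq) (closingEdge G node-injective k≢1 joins (preserves i))
  injective {suc i} {suc j} eq = cong suc (edge-injective eq)

walkPath : ∀ G {x z ys} → Walk (Adjacent G) x z ys → Unique (x ∷ ys) → Path G (length ys)
walkPath G w uq = toPath G (lookup-injective uq) (proj₁ ∘ walk-step w) (proj₂ ∘ walk-step w)

module _ (T : Graph) where

  open DecMembership (_≟_ {Graph.#nodes T}) using (_∈?_)

  -- The node added last comes first.
  data Growth : List (Node T) → Set where
    root : ∀ r → Growth (r ∷ [])
    leaf : ∀ {t p xs} → t ∉ xs → p ∈ xs → Adjacent T t p → Growth xs → Growth (t ∷ xs)

  growth-unique : ∀ {xs} → Growth xs → Unique xs
  growth-unique (root r)        = [] ∷ []
  growth-unique (leaf t∉ _ _ o) = ¬Any⇒All¬ _ t∉ ∷ growth-unique o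

  -- From or to the node added last, the path leads through its parent and then among the older
  -- nodes. Knowing that these are all in `xs` keeps the nodes of the extended path distinct.
  simplePath : ∀ {xs a b} → Growth xs → a ∈ xs → b ∈ xs →
               ∃[ ys ] (Walk (Adjacent T) a b ys × Unique (a ∷ ys) × All (_∈ xs) ys)
  simplePath (root r) (here refl) (here refl) = [] , [] , [] ∷ [] , []
  simplePath (leaf _ _ _ _) (here refl) (here refl) = [] , [] , [] ∷ [] , []
  simplePath {t ∷ xs} (leaf {p = p} t∉ p∈ tp o) (here refl) (there b∈) with simplePath o p∈ b∈
  ... | ys , w , uq , ys∈ = p ∷ ys , tp ∷ w , All.tabulate fresh ∷ uq , there p∈ ∷ All.map there ys∈
    where
    fresh : ∀ {y} → y ∈ p ∷ ys → t ≢ y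
    fresh (here refl) refl = t∉ p∈
    fresh (there y∈)  refl = t∉ (All.lookup ys∈ y∈)
  simplePath {t ∷ xs} (leaf {p = p} t∉ p∈ tp o) (there a∈) (here refl) with simplePath o a∈ p∈
  ... | ys , w , uq , ys∈ = ys ∷ʳ t , walk-snoc w (adjacent-sym T tp)
                          , Unique.++⁺ uq ([] ∷ []) disjoint , ++⁺ (All.map there ys∈) (here refl ∷ [])
    where
    disjoint : ∀ {y} → ¬ (y ∈ _ ∷ ys × y ∈ t ∷ [])
    disjoint (here refl , here refl) = t∉ a∈
    disjoint (there y∈  , here refl) = t∉ (All.lookup ys∈ y∈)
  simplePath (leaf _ _ _ o) (there a∈) (there b∈) with simplePath o a∈ b∈
  ... | ys , w , uq , ys∈ = ys , w , uq , All.map there ys∈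

  -- A second neighbour `s` of `t` would close a cycle: from `t` to `p`, along a simple path in `xs`
  -- to `s`, and back.
  parent-unique : Acyclic T → ∀ {xs t p s} → Growth xs → t ∉ xs → p ∈ xs → Adjacent T t p →
                  s ∈ xs → Adjacent T t s → s ≡ p
  parent-unique acyclic {xs} {t} {p} {s} o t∉ p∈ tp s∈ ts with s ≟ p
  ... | yes eq = eq
  ... | no s≢p with simplePath o p∈ s∈
  ...   | [] , [] , _ = contradiction refl s≢p
  ...   | ys@(_ ∷ _) , w , uq , ys∈ = contradiction
          -- As `ys` is nonempty, the path has at least two edges and cannot be the exceptional one
          -- of length 1.
          (closeCycle T (walkPath T (tp ∷ w) uq′) (λ ()) (subst (Adjacent T t) (sym (walk-end w)) ts))
          (acyclic _)
    where
    fresh : ∀ {y} → y ∈ p ∷ ys → t ≢ y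
    fresh (here refl) refl = t∉ p∈
    fresh (there y∈)  refl = t∉ (All.lookup ys∈ y∈)
    uq′ : Unique (t ∷ p ∷ ys)
    uq′ = All.tabulate fresh ∷ uq

  crossing : ∀ {xs u w} → u ∈ xs → w ∉ xs → Star (Adjacent T) u w →
             ∃₂ λ p t → p ∈ xs × t ∉ xs × Adjacent T t p
  crossing u∈ w∉ ε = contradiction u∈ w∉
  crossing {xs} u∈ w∉ (_◅_ {j = v} uv vw) with v ∈? xs
  ... | yes v∈ = crossing v∈ w∉ vw
  ... | no v∉  = _ , _ , u∈ , v∉ , adjacent-sym T uv

  growth-nonempty : ∀ {xs} → Growth xs → ∃[ r ] r ∈ xs
  growth-nonempty (root r)       = r , here refl
  growth-nonempty (leaf _ _ _ _) = _ , here refl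

  spanning : Connected T → ∃[ xs ] (Growth xs × ∀ x → x ∈ xs)
  spanning C = grow (Graph.#nodes T) (root someNode) (ℕ.m<m+n _ (s≤s z≤n))
    where
    open Connected C
    grow : ∀ fuel {xs} → Growth xs → Graph.#nodes T < fuel + length xs → ∃[ xs ] (Growth xs × ∀ x → x ∈ xs)
    -- Without fuel, `xs` would be a list of distinct nodes that is longer than the number of nodes.
    grow zero {xs} o n< = contradiction (injective⇒≤ (lookup-injective (growth-unique o))) (ℕ.<⇒≱ n<)
    grow (suc fuel) {xs} o n< with all? (_∈? xs)
    ... | yes all = xs , o , all
    ... | no ¬all with ¬∀⟶∃¬ _ (_∈ xs) (_∈? xs) ¬all | growth-nonempty o
    ...   | w , w∉ | r , r∈ with crossing r∈ w∉ (reachable r w)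
    ...     | p , t , p∈ , t∉ , tp =
      grow fuel (leaf t∉ p∈ tp o) (ℕ.<-≤-trans n< (ℕ.≤-reflexive (sym (ℕ.+-suc fuel (length xs)))))

  module _ {V : Set} (_≟ⱽ_ : DecidableEquality V) (acyclic : Acyclic T) (D : Decomposition T V)
           (R : V → V → Set) where

    open Decomposition D using (bag; connected)
    open DecMembership _≟ⱽ_ using () renaming (_∈?_ to _∈ⱽ?_)

    private
      Within : List (Node T) → V → Node T → Node T → Set
      Within xs v a b = (a ∈ xs × v ∈ bag a) × (b ∈ xs × v ∈ bag b) × Adjacent T a b

      module _ {t p xs} (t∉ : t ∉ xs) (p∈ : p ∈ xs) (tp : Adjacent T t p) (o : Growth xs) where

        -- A walk from the leaf into `xs` can enter it only at the parent, apart from steps that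
        -- stay at the leaf.
        viaParent : ∀ {v i} → i ∈ xs → Star (Within (t ∷ xs) v) t i → v ∈ bag p
        viaParent i∈ ε = contradiction i∈ t∉
        viaParent i∈ ((_ , (here refl , _) , _) ◅ rest) = viaParent i∈ rest
        viaParent i∈ ((_ , (there s∈ , v∈s) , ts) ◅ _) =
          subst (λ s → _ ∈ bag s) (parent-unique acyclic o t∉ p∈ tp s∈ ts) v∈s

        mutual
          -- A walk that visits the leaf comes from `p` and returns to `p`, so the visit can be cut
          -- out. This lets the search continue after the leaf is dropped.
          shortcut : ∀ {v i j} → i ∈ xs → j ∈ xs → Star (Within (t ∷ xs) v) i j → Star (Within xs v) i j
          shortcut i∈ j∈ ε = ε
          shortcut i∈ j∈ (((_ , v∈i) , (there s∈ , v∈s) , is) ◅ rest) =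
            ((i∈ , v∈i) , (s∈ , v∈s) , is) ◅ shortcut s∈ j∈ rest
          shortcut i∈ j∈ ((_ , (here refl , _) , it) ◅ rest)
            with refl ← parent-unique acyclic o t∉ p∈ tp i∈ (adjacent-sym T it) = fromLeaf j∈ rest

          fromLeaf : ∀ {v j} → j ∈ xs → Star (Within (t ∷ xs) v) t j → Star (Within xs v) p j
          fromLeaf j∈ ε = contradiction j∈ t∉
          fromLeaf j∈ ((_ , (here refl , _) , _) ◅ rest) = fromLeaf j∈ rest
          fromLeaf j∈ ((_ , (there s∈ , _) , ts) ◅ rest)
            with refl ← parent-unique acyclic o t∉ p∈ tp s∈ ts = shortcut s∈ j∈ rest

      -- Empty bags are dropped like any bag contained in the next one; the nonempty bag carried
      -- along guarantees a node in the bag that remains at the root.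
      search : ∀ {xs} → Growth xs →
               (∀ {v i j} → i ∈ xs → j ∈ xs → v ∈ bag i → v ∈ bag j → Star (Within xs v) i j) →
               (∃₂ λ i v → i ∈ xs × v ∈ bag i) →
               (∀ {u w} → R u w → ∃[ i ] (i ∈ xs × u ∈ bag i × w ∈ bag i)) →
               ∃₂ λ i v → v ∈ bag i × ∀ {w} → R v w → w ∈ bag i
      search (root r) conn (i , v , here refl , v∈) covers = r , v , v∈ , neighbours
        where
        neighbours : ∀ {w} → R v w → w ∈ bag r
        neighbours vw with covers vw
        ... | _ , here refl , _ , w∈ = w∈
      search (leaf {t} {p} {xs} t∉ p∈ tp o) conn (i₀ , v₀ , i₀∈ , v₀∈) covers
        with All.all? (_∈ⱽ? bag p) (bag t)
      ... | yes t⊆p = search o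
        (λ i∈ j∈ v∈i v∈j → shortcut t∉ p∈ tp o i∈ j∈ (conn (there i∈) (there j∈) v∈i v∈j))
        (someBag i₀∈ v₀∈)
        (λ uw → let i , i∈ , u∈ , w∈ = covers uw in moved i∈ u∈ w∈)
        where
        moved : ∀ {i u w} → i ∈ t ∷ xs → u ∈ bag i → w ∈ bag i → ∃[ i ] (i ∈ xs × u ∈ bag i × w ∈ bag i)
        moved (here refl) u∈ w∈ = p , p∈ , All.lookup t⊆p u∈ , All.lookup t⊆p w∈
        moved (there i∈)  u∈ w∈ = _ , i∈ , u∈ , w∈
        someBag : ∀ {i v} → i ∈ t ∷ xs → v ∈ bag i → ∃₂ λ i v → i ∈ xs × v ∈ bag i
        someBag i∈ v∈ = let i , i∈ , v∈ , _ = moved i∈ v∈ v∈ in i , _ , i∈ , v∈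
      ... | no t⊈p with find (¬All⇒Any¬ (_∈ⱽ? bag p) _ t⊈p)
      ...   | v , v∈t , v∉p = t , v , v∈t , neighbours
        where
        neighbours : ∀ {w} → R v w → w ∈ bag t
        neighbours vw with covers vw
        ... | _ , here refl , _ , w∈ = w∈
        -- A common bag elsewhere would contain `v`, and the bags of `v` would lead to it from `t`
        -- through `p`; but `v` was chosen outside `bag p`.
        ... | i , there i∈ , v∈i , _ =
          contradiction (viaParent t∉ p∈ tp o i∈ (conn (here refl) (there i∈) v∈t v∈i)) v∉p

    -- A bag at a leaf of the tree either is contained in the next bag, so that the leaf
    -- can be dropped, or contains a node that is in no other bag.
    nodeInOneBag : Connected T → (∃[ v ] Together D v v) → (∀ {u w} → R u w → Together D u w) →
                   ∃₂ λ i v → v ∈ bag i × ∀ {w} → R v w → w ∈ bag i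
    nodeInOneBag C (v , i , v∈i , _) covers with spanning C
    ... | xs , o , all = search o
      (λ _ _ v∈i v∈j → Star.map (λ (v∈a , v∈b , ab) → (all _ , v∈a) , (all _ , v∈b) , ab) (connected _ _ _ v∈i v∈j))
      (i , v , all i , v∈i)
      (λ uw → let i , u∈ , w∈ = covers uw in i , all i , u∈ , w∈)

-- Long double ears in 4-regular graphs

-- A doubled path with at least two edges, and a chord joining its ends; R₁ and R₂
-- stand for the pairs of nodes joined by at least one and at least two edges.
Long : {V : Set} (R₁ R₂ : V → V → Set) → Set
Long R₁ R₂ = ∃₂ λ x z → ∃[ ys ] (Walk R₂ x z ys × Unique (x ∷ ys) × 2 ≤ length ys × R₁ x z)

-- X is an alternative outcome: below, the existence of a triple edge.
record Pinched {T : Graph} {V : Set} (D : Decomposition T V) (X : Set) (R₁ R₂ : V → V → Set) : Set where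
  field
    sym₁    : ∀ {u w} → R₁ u w → R₁ w u
    sym₂    : ∀ {u w} → R₂ u w → R₂ w u
    weaken  : ∀ {u w} → R₂ u w → R₁ u w
    R₁?     : ∀ u w → Dec (R₁ u w)
    irrefl  : ∀ {v} → ¬ R₁ v v
    covered : ∀ {u w} → R₁ u w → Together D u w
    -- In a 4-regular graph without loops and triple edges, this is what having at most
    -- two neighbours amounts to; unlike regularity, it is stated without degrees.
    pinch   : ∀ {v} → Together D v v → ∀ {a b} → (∀ {w} → R₁ v w → w ≡ a ⊎ w ≡ b) →
              X ⊎ (a ≢ b × R₂ v a × R₂ v b)

module Contraction
  {T : Graph} {V : Set} (_≟ⱽ_ : DecidableEquality V) {D : Decomposition T V} {X : Set} {R₁ R₂ : V → V → Set}
  (S : Pinched D X R₁ R₂) {v a b : V} (neighbours : ∀ {w} → R₁ v w → w ≡ a ⊎ w ≡ b)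
  (a≢b : a ≢ b) (va : R₂ v a) (vb : R₂ v b) (¬ab : ¬ R₁ a b) where

  open Pinched S

  -- Instead of the double edges va and vb there is a double edge ab.
  Contracted : (V → V → Set) → V → V → Set
  Contracted R x y = (x ≢ v × y ≢ v) × (R x y ⊎ (x , y) ∼ (a , b))

  private
    R₁′ = Contracted R₁
    R₂′ = Contracted R₂

    irrefl₂ : ∀ {x y} → R₂ x y → x ≢ y
    irrefl₂ r refl = irrefl (weaken r)

    a≢v : a ≢ v
    a≢v = ≢-sym (irrefl₂ va)

    b≢v : b ≢ v
    b≢v = ≢-sym (irrefl₂ vb)

    toPair : ∀ {x y} → (x , y) ∼ (a , b) → R₂ v x × R₂ v y
    toPair (inj₁ refl) = va , vb
    toPair (inj₂ refl) = vb , va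

    f : V → V
    f x with x ≟ⱽ v
    ... | yes _ = a
    ... | no _  = x

    f-v : f v ≡ a
    f-v with v ≟ⱽ v
    ... | yes _  = refl
    ... | no v≢v = contradiction refl v≢v

    f-≢ : ∀ {x} → x ≢ v → f x ≡ x
    f-≢ {x} x≢v with x ≟ⱽ v
    ... | yes x≡v = contradiction x≡v x≢v
    ... | no _    = refl

    FibreStep : V → V → Set
    FibreStep x y = f x ≡ f y × Together D x y

    va-fibre : FibreStep v a
    va-fibre = trans f-v (sym (f-≢ a≢v)) , covered (weaken va)

    fibres : ∀ {x y} → f x ≡ f y → Star FibreStep x y
    fibres {x} {y} eq with x ≟ⱽ v | y ≟ⱽ v
    fibres eq   | yes refl | yes refl = ε
    fibres refl | yes refl | no _     = va-fibre ◅ ε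
    fibres refl | no _     | yes refl = (sym (proj₁ va-fibre) , Decomposition.together-sym D (proj₂ va-fibre)) ◅ ε
    fibres refl | no _     | no _     = ε

  -- The edge `va` is contracted into `a`. The type `V` stays the same, but `v` is now in no bag;
  -- the nodes of the current graph are those that occur in some bag.
  contracted : Decomposition T V
  contracted = minor D f fibres

  private
    moved : ∀ {x y} → Together D x y → Together contracted (f x) (f y)
    moved = minor-together D f fibres

    symC : ∀ {R} → (∀ {x y} → R x y → R y x) → ∀ {x y} → Contracted R x y → Contracted R y x
    symC sy ((p , q) , inj₁ r)           = (q , p) , inj₁ (sy r)
    symC sy ((p , q) , inj₂ (inj₁ refl)) = (q , p) , inj₂ (inj₂ refl)
    symC sy ((p , q) , inj₂ (inj₂ refl)) = (q , p) , inj₂ (inj₁ refl)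

    covered′ : ∀ {x y} → R₁′ x y → Together contracted x y
    covered′ ((p , q) , inj₁ r) = subst₂ (Together contracted) (f-≢ p) (f-≢ q) (moved (covered r))
    covered′ (_ , inj₂ (inj₁ refl)) = subst₂ (Together contracted) f-v (f-≢ b≢v) (moved (covered (weaken vb)))
    covered′ (_ , inj₂ (inj₂ refl)) =
      subst₂ (Together contracted) (f-≢ b≢v) f-v (moved (covered (sym₁ (weaken vb))))

  contracted-nodes : ∀ {x} → Together contracted x x → x ≢ v × Together D x x
  contracted-nodes (i , x∈ , _) with ∈-map⁻ f x∈
  ... | y , y∈ , refl with y ≟ⱽ v
  ...   | yes refl = a≢v , let j , _ , a∈ = covered (weaken va) in j , a∈ , a∈
  ...   | no y≢v   = y≢v , i , y∈ , y∈

  contracted-node : Together contracted a a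
  contracted-node = let j , _ , a∈ = covered (weaken va) in
                    subst₂ (Together contracted) (f-≢ a≢v) (f-≢ a≢v) (moved (j , a∈ , a∈))

  private
    -- For `p` the contraction exchanges the neighbour `v` for `q`, which was no neighbour before.
    -- So the neighbours `q` and `d` afterwards were `v` and `d`, to which the old `pinch` applies.
    pinchAtEnd : ∀ {p q} → (p , q) ∼ (a , b) → p ≢ v → q ≢ v → ¬ R₁ p q → Together D p p → ∀ {d} →
                 (∀ {w} → R₁′ p w → w ≡ q ⊎ w ≡ d) → X ⊎ (q ≢ d × R₂′ p q × R₂′ p d)
    pinchAtEnd {p} {q} pq p≢v q≢v ¬pq live {d} nbrs = Sum.map₂ conclude (pinch live old)
      where
      old : ∀ {w} → R₁ p w → w ≡ v ⊎ w ≡ d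
      old {w} pw with w ≟ⱽ v
      ... | yes w≡v = inj₁ w≡v
      ... | no w≢v with nbrs ((p≢v , w≢v) , inj₁ pw)
      ...   | inj₁ refl = contradiction pw ¬pq
      ...   | inj₂ w≡d  = inj₂ w≡d
      conclude : v ≢ d × R₂ p v × R₂ p d → q ≢ d × R₂′ p q × R₂′ p d
      conclude (v≢d , _ , pd) = (λ { refl → ¬pq (weaken pd) })
                              , ((p≢v , q≢v) , inj₂ pq) , ((p≢v , ≢-sym v≢d) , inj₁ pd)

    pinchAtEnd′ : ∀ {p q} → (p , q) ∼ (a , b) → p ≢ v → q ≢ v → ¬ R₁ p q → Together D p p → ∀ {c d} →
                  (∀ {w} → R₁′ p w → w ≡ c ⊎ w ≡ d) → X ⊎ (c ≢ d × R₂′ p c × R₂′ p d)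
    pinchAtEnd′ pq p≢v q≢v ¬pq live nbrs with nbrs ((p≢v , q≢v) , inj₂ pq)
    ... | inj₁ refl = pinchAtEnd pq p≢v q≢v ¬pq live nbrs
    ... | inj₂ refl = Sum.map₂ (λ (d≢c , x , y) → ≢-sym d≢c , y , x)
                               (pinchAtEnd pq p≢v q≢v ¬pq live (Sum.swap ∘ nbrs))

    pinch′ : ∀ {x} → Together contracted x x → ∀ {c d} → (∀ {w} → R₁′ x w → w ≡ c ⊎ w ≡ d) →
             X ⊎ (c ≢ d × R₂′ x c × R₂′ x d)
    pinch′ {x} live {c} {d} nbrs with x ≟ⱽ a | x ≟ⱽ b | contracted-nodes live
    ... | yes refl | _        | x≢v , live′ = pinchAtEnd′ (inj₁ refl) a≢v b≢v ¬ab live′ nbrs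
    ... | no _     | yes refl | x≢v , live′ = pinchAtEnd′ (inj₂ refl) b≢v a≢v (¬ab ∘ sym₁) live′ nbrs
    ... | no x≢a   | no x≢b   | x≢v , live′ = Sum.map₂ conclude (pinch live′ λ xw → nbrs ((x≢v , away xw) , inj₁ xw))
      where
      away : ∀ {w} → R₁ x w → w ≢ v
      away xv refl with neighbours (sym₁ xv)
      ... | inj₁ x≡a = x≢a x≡a
      ... | inj₂ x≡b = x≢b x≡b
      conclude : c ≢ d × R₂ x c × R₂ x d → c ≢ d × R₂′ x c × R₂′ x d
      conclude (c≢d , xc , xd) = c≢d , ((x≢v , away (weaken xc)) , inj₁ xc) , ((x≢v , away (weaken xd)) , inj₁ xd)

    R₁′? : ∀ x y → Dec (R₁′ x y)
    R₁′? x y = (¬? (x ≟ⱽ v) ×-dec ¬? (y ≟ⱽ v)) ×-dec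
               (R₁? x y ⊎-dec (≡-dec _≟ⱽ_ _≟ⱽ_ (x , y) (a , b) ⊎-dec ≡-dec _≟ⱽ_ _≟ⱽ_ (x , y) (b , a)))

  contracted-pinched : Pinched contracted X R₁′ R₂′
  contracted-pinched = record
    { sym₁    = symC sym₁
    ; sym₂    = symC sym₂
    ; weaken  = λ (p , r) → p , Sum.map₁ weaken r
    ; R₁?     = R₁′?
    ; irrefl  = λ { (_ , inj₁ r)           → irrefl r
                  ; (_ , inj₂ (inj₁ refl)) → a≢b refl
                  ; (_ , inj₂ (inj₂ refl)) → a≢b refl }
    ; covered = covered′
    ; pinch   = pinch′
    }

  private
    avoids : ∀ {x z ys} → Walk R₂′ x z ys → All (_≢ v) ys
    avoids []                  = []
    avoids (((_ , q) , _) ∷ w) = q ∷ avoids w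

    -- Serves the rest of a walk once an end `s` of the pair `ab` has been passed: without repeated
    -- nodes, the pair cannot occur again.
    unaffected : ∀ {s x z ys} → s ≡ a ⊎ s ≡ b → s ∉ x ∷ ys → Walk R₂′ x z ys → Walk R₂ x z ys
    unaffected s≡ s∉ []                   = []
    unaffected s≡ s∉ ((_ , inj₁ r) ∷ w)   = r ∷ unaffected s≡ (s∉ ∘ there) w
    unaffected (inj₁ refl) s∉ ((_ , inj₂ (inj₁ refl)) ∷ _) = contradiction (here refl) s∉
    unaffected (inj₁ refl) s∉ ((_ , inj₂ (inj₂ refl)) ∷ _) = contradiction (there (here refl)) s∉
    unaffected (inj₂ refl) s∉ ((_ , inj₂ (inj₁ refl)) ∷ _) = contradiction (there (here refl)) s∉
    unaffected (inj₂ refl) s∉ ((_ , inj₂ (inj₂ refl)) ∷ _) = contradiction (here refl) s∉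

    pairˡ : ∀ {x y} → (x , y) ∼ (a , b) → x ≡ a ⊎ x ≡ b
    pairˡ (inj₁ refl) = inj₁ refl
    pairˡ (inj₂ refl) = inj₂ refl

    -- A step from `a` to `b` or back is led through `v`, which no walk after the contraction
    -- visits. The last component tells where the nodes come from, to keep them distinct.
    detour : ∀ {x z ys} → Walk R₂′ x z ys → Unique (x ∷ ys) →
             ∃[ ys′ ] (Walk R₂ x z ys′ × Unique (x ∷ ys′) × length ys ≤ length ys′ ×
                       (∀ {y} → y ∈ ys′ → y ∈ ys ⊎ y ≡ v))
    detour [] uq = [] , [] , uq , z≤n , λ ()
    detour {ys = y ∷ ys} (((x≢v , y≢v) , inj₂ pair) ∷ w) (x∉ ∷ uq) =
        v ∷ y ∷ ys
      , sym₂ (proj₁ (toPair pair)) ∷ proj₂ (toPair pair) ∷ unaffected (pairˡ pair) (All¬⇒¬Any x∉) w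
      , (x≢v ∷ x∉) ∷ (≢-sym y≢v ∷ All.map ≢-sym (avoids w)) ∷ uq
      , ℕ.n≤1+n _
      , λ { (here eq) → inj₂ eq ; (there y∈) → inj₁ y∈ }
    detour {x} {ys = y ∷ ys} (((x≢v , _) , inj₁ r) ∷ w) ((x≢y ∷ x∉) ∷ uq) with detour w uq
    ... | ys′ , w′ , uq′ , len , sub =
        y ∷ ys′ , r ∷ w′ , All.tabulate fresh ∷ uq′ , s≤s len
      , λ { (here eq) → inj₁ (here eq) ; (there y∈) → Sum.map₁ there (sub y∈) }
      where
      fresh : ∀ {u} → u ∈ y ∷ ys′ → x ≢ u
      fresh (here refl) = x≢y
      fresh (there u∈) with sub u∈
      ... | inj₁ u∈ys = All.lookup x∉ u∈ys
      ... | inj₂ refl = x≢v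

    pair-unique : ∀ {x y z} → (x , y) ∼ (a , b) → (x , z) ∼ (a , b) → y ≡ z
    pair-unique (inj₁ refl) (inj₁ refl) = refl
    pair-unique (inj₁ refl) (inj₂ refl) = contradiction refl a≢b
    pair-unique (inj₂ refl) (inj₁ refl) = contradiction refl a≢b
    pair-unique (inj₂ refl) (inj₂ refl) = refl

    closed-trivial : ∀ {R : V → V → Set} {x ys} → Walk R x x ys → Unique (x ∷ ys) → ys ≡ []
    closed-trivial []      _        = refl
    closed-trivial {x = x} {ys} w@(_ ∷ _) (x∉ ∷ _) = contradiction (last∈ w) (All¬⇒¬Any x∉)
      where
      last∈ : ∀ {R : V → V → Set} {x y z ys} → Walk R x z (y ∷ ys) → z ∈ y ∷ ys
      last∈ (_ ∷ [])        = here refl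
      last∈ (_ ∷ w@(_ ∷ _)) = there (last∈ w)

  -- If the double edge ab is on the doubled path, the path is led through v; if it
  -- provides the chord, the path is extended to v.
  lift : Long R₁′ R₂′ → Long R₁ R₂
  lift (x , z , ys , w , uq , 2≤ , _ , inj₁ xz) with detour w uq
  ... | ys′ , w′ , uq′ , len , _ = x , z , ys′ , w′ , uq′ , ℕ.≤-trans 2≤ len , xz
  -- Were the pair `ab` both the first step and the chord, `y` would be `z` and the path would have
  -- a single edge.
  lift (x , z , y ∷ ys , (_ , inj₂ xy) ∷ w , _ ∷ uq , 2≤ , _ , inj₂ xz)
    with refl ← pair-unique xy xz with refl ← closed-trivial w uq = contradiction 2≤ λ { (s≤s ()) }
  lift (x , z , y ∷ ys , w@((_ , inj₁ r) ∷ w′) , uq@(x∉ ∷ _) , 2≤ , (x≢v , _) , inj₂ xz) =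
    v , z , x ∷ y ∷ ys
    , proj₁ (toPair xz) ∷ r ∷ unaffected (pairˡ xz) (All¬⇒¬Any x∉) w′
    , (≢-sym x≢v ∷ All.map ≢-sym (avoids w)) ∷ uq
    , s≤s (s≤s z≤n)
    , weaken (proj₂ (toPair xz))

-- Shorter lists are filled up by repetition; that the two neighbours differ is left to `pinch`.
others : ∀ {V : Set} {v : V} (xs : List V) → length xs ≤ 3 → v ∈ xs →
         ∃₂ λ a b → ∀ {x} → x ∈ xs → x ≡ v ⊎ x ≡ a ⊎ x ≡ b
others {v = v} (_ ∷ []) _ (here refl) = v , v , λ { (here eq) → inj₁ eq }
others {v = v} (_ ∷ y ∷ []) _ (here refl) =
  y , y , λ { (here eq) → inj₁ eq ; (there (here eq)) → inj₂ (inj₁ eq) }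
others (x ∷ _ ∷ []) _ (there (here refl)) =
  x , x , λ { (here eq) → inj₂ (inj₁ eq) ; (there (here eq)) → inj₁ eq }
others (_ ∷ y ∷ z ∷ []) _ (here refl) = y , z , λ where
  (here eq)                 → inj₁ eq
  (there (here eq))         → inj₂ (inj₁ eq)
  (there (there (here eq))) → inj₂ (inj₂ eq)
others (x ∷ _ ∷ z ∷ []) _ (there (here refl)) = x , z , λ where
  (here eq)                 → inj₂ (inj₁ eq)
  (there (here eq))         → inj₁ eq
  (there (there (here eq))) → inj₂ (inj₂ eq)
others (x ∷ y ∷ _ ∷ []) _ (there (there (here refl))) = x , y , λ where
  (here eq)                 → inj₂ (inj₁ eq)
  (there (here eq))         → inj₂ (inj₂ eq)
  (there (there (here eq))) → inj₁ eq
others (_ ∷ _ ∷ _ ∷ _ ∷ _) (s≤s (s≤s (s≤s ()))) _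

module _ {T : Graph} (isTree : IsTree T) {V : Set} (_≟ⱽ_ : DecidableEquality V) {X : Set} where

  -- Some node shares one bag with all its neighbours. Besides the node itself, a bag of three
  -- entries has room for two.
  twoNeighbours : ∀ {D : Decomposition T V} {R₁ R₂} → Pinched D X R₁ R₂ → (∃[ v ] Together D v v) →
                  ∃[ v ] (Together D v v × ∃₂ λ a b → ∀ {w} → R₁ v w → w ≡ a ⊎ w ≡ b)
  twoNeighbours {D} {R₁} S live
    with nodeInOneBag T _≟ⱽ_ (proj₂ isTree) D R₁ (proj₁ isTree) live (Pinched.covered S)
  ... | i , v , v∈i , nbrs⊆i with others (Decomposition.bag D i) (Decomposition.small D i) v∈i
  ...   | a , b , bag⊆ = v , (i , v∈i , v∈i) , a , b , nbrs
    where
    nbrs : ∀ {w} → R₁ v w → w ≡ a ⊎ w ≡ b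
    nbrs vw with bag⊆ (nbrs⊆i vw)
    ... | inj₁ refl = contradiction vw (Pinched.irrefl S)
    ... | inj₂ w≡   = w≡

  -- The list `xs` bounds the nodes that occur in a bag and provides the measure: each contraction
  -- removes `v` from it, while `a` witnesses that some node is left.
  findLong : ∀ fuel (xs : List V) → length xs ≤ fuel → {D : Decomposition T V} {R₁ R₂ : V → V → Set} →
             Pinched D X R₁ R₂ → (∀ {v} → Together D v v → v ∈ xs) → (∃[ v ] Together D v v) → X ⊎ Long R₁ R₂
  findLong zero [] _ S live⊆ (_ , live) = contradiction (live⊆ live) λ ()
  findLong (suc fuel) xs len S live⊆ live with twoNeighbours S live
  ... | v , v-live , a , b , nbrs with Pinched.pinch S v-live nbrs
  ...   | inj₁ x = inj₁ x
  ...   | inj₂ (a≢b , va , vb) with Pinched.R₁? S a b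
  ...     | yes ab = inj₂ (a , b , v ∷ b ∷ [] , sym₂ va ∷ vb ∷ [] ,
            ((λ { refl → irrefl (weaken va) }) ∷ a≢b ∷ []) ∷ ((λ { refl → irrefl (weaken vb) }) ∷ []) ∷ [] ∷ [] ,
            s≤s (s≤s z≤n) , ab)
    where open Pinched S
  ...     | no ¬ab = Sum.map₂ C.lift
            (findLong fuel (filter other? xs) shorter C.contracted-pinched live′ (a , C.contracted-node))
    where
    module C = Contraction _≟ⱽ_ S nbrs a≢b va vb ¬ab
    other? : ∀ x → Dec (x ≢ v)
    other? x = ¬? (x ≟ⱽ v)
    shorter : length (filter other? xs) ≤ fuel
    shorter = s≤s⁻¹ (ℕ.≤-trans (filter-notAll other? xs (lose (live⊆ v-live) λ v≢v → v≢v refl)) len)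
    live′ : ∀ {x} → Together C.contracted x x → x ∈ filter other? xs
    live′ tog = let x≢v , tog′ = C.contracted-nodes tog in ∈-filter⁺ other? (live⊆ tog′) x≢v

-- Undoing the steps

term≤sum : ∀ {n} (f : Vector ℕ n) i → f i ≤ sum f
term≤sum f i = ℕ.≤-trans (ℕ.m≤n+m (f i) _) (ℕ.≤-reflexive (sum-updateAt f i 0))

two≤sum : ∀ {n} (f : Vector ℕ n) {i j} → i ≢ j → f i + f j ≤ sum f
two≤sum f {i} {j} i≢j = ℕ.≤-trans
  (ℕ.+-monoʳ-≤ (f i) (ℕ.≤-trans (ℕ.≤-reflexive (sym (updateAt-minimal j i f (≢-sym i≢j)))) (term≤sum _ j)))
  (ℕ.≤-trans (ℕ.≤-reflexive (ℕ.+-comm (f i) _)) (ℕ.≤-reflexive (sum-updateAt f i 0)))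

-- For `share v ∘ ends` these are the edges at `v`. If none of them is a loop, each counts once and
-- their number is the degree.
record Support {n : ℕ} (f : Vector ℕ n) : Set where
  field
    elements : List (Fin n)
    unique   : Unique elements
    positive : All (λ i → 1 ≤ f i) elements
    complete : ∀ {i} → 1 ≤ f i → i ∈ elements
    size     : length elements ≡ sum f

support : ∀ {n} (f : Vector ℕ n) → (∀ i → f i ≤ 1) → Support f
support {zero}  f f≤1 = record
  { elements = [] ; unique = [] ; positive = [] ; complete = λ { {()} } ; size = refl }
support {suc n} f f≤1 with f zero in eq | f≤1 zero
... | suc (suc _) | s≤s ()
... | zero  | _ = record
  { elements = List.map suc elements
  ; unique   = Unique.map⁺ suc-injective unique
  ; positive = All.map⁺ positive
  ; complete = λ { {zero} 1≤ → contradiction (subst (1 ≤_) eq 1≤) λ () ; {suc i} 1≤ → ∈-map⁺ suc (complete 1≤) }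
  ; size     = trans (trans (length-map suc elements) size) (cong (_+ sum (f ∘ suc)) (sym eq))
  }
  where open Support (support (f ∘ suc) (f≤1 ∘ suc))
... | suc zero | _ = record
  { elements = zero ∷ List.map suc elements
  ; unique   = All.map⁺ (All.tabulate λ _ ()) ∷ Unique.map⁺ suc-injective unique
  ; positive = subst (1 ≤_) (sym eq) (s≤s z≤n) ∷ All.map⁺ positive
  ; complete = λ { {zero} _ → here refl ; {suc i} 1≤ → there (∈-map⁺ suc (complete 1≤)) }
  ; size     = trans (cong suc (trans (length-map suc elements) size)) (cong (_+ sum (f ∘ suc)) (sym eq))
  }
  where open Support (support (f ∘ suc) (f≤1 ∘ suc))

share≤1 : ∀ {n} {v : Fin n} p → p ≢ (v , v) → share v p ≤ 1
share≤1 {v = v} (x , y) ≢vv with x ≟ v | y ≟ v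
... | yes refl | yes refl = contradiction refl ≢vv
... | yes _    | no _     = s≤s z≤n
... | no _     | yes _    = s≤s z≤n
... | no _     | no _     = z≤n

1≤share⇒∼ : ∀ {n} {v : Fin n} p → 1 ≤ share v p → ∃[ w ] p ∼ (v , w)
1≤share⇒∼ {v = v} (x , y) 1≤ with x ≟ v | y ≟ v
... | yes refl | _        = y , inj₁ refl
... | no _     | yes refl = x , inj₂ refl
1≤share⇒∼ {v = v} (x , y) () | no _ | no _

-- The path keeps the edges `keep`; `chord` and the edges `dup` are to be removed.
record Ear (G : Graph) : Set where
  field
    {k}             : ℕ
    node            : Fin (suc k) → Node G
    node-injective  : Injective _≡_ _≡_ node
    chord           : Edge G
    keep dup        : Fin k → Edge G
    chord-joins     : Joins G chord (node zero) (node (fromℕ k))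
    keep-joins      : ∀ i → Joins G (keep i) (node (inject₁ i)) (node (suc i))
    dup-joins       : ∀ i → Joins G (dup i) (node (inject₁ i)) (node (suc i))
    keep≢dup        : ∀ i → keep i ≢ dup i
    chord≢keep      : ∀ i → chord ≢ keep i
    chord≢dup       : ∀ i → chord ≢ dup i

-- With `D` listing the edges to be deleted, `κ` numbers the remaining ones afresh, as the edges of
-- the smaller graph.
record Complement {j m : ℕ} (D : Fin j → Fin m) : Set where
  field
    {size}    : ℕ
    κ         : Fin size → Fin m
    injective : Injective _≡_ _≡_ κ
    disjoint  : ∀ a i → κ a ≢ D i
    covers    : ∀ x → (∃[ a ] κ a ≡ x) ⊎ (∃[ i ] D i ≡ x)

complement : ∀ {j m} (D : Fin j → Fin m) → Injective _≡_ _≡_ D → Complement D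
complement {zero}          D inj = record
  { κ = id ; injective = id ; disjoint = λ _ () ; covers = λ x → inj₁ (x , refl) }
complement {suc j} {zero}  D inj = contradiction (D zero) λ ()
complement {suc j} {suc m} D inj = record
  { κ         = punchIn (D zero) ∘ κ
  ; injective = injective ∘ punchIn-injective (D zero) _ _
  ; disjoint  = λ where
      a zero    → punchInᵢ≢i (D zero) (κ a)
      a (suc i) → λ eq → disjoint a i
        (punchIn-injective (D zero) _ _ (trans eq (sym (punchIn-punchOut (apart i)))))
  ; covers    = covers′
  }
  where
  apart : ∀ i → D zero ≢ D (suc i)
  apart i eq = contradiction (inj eq) λ ()
  open Complement (complement (λ i → punchOut (apart i))
                              (λ eq → suc-injective (inj (punchOut-injective (apart _) (apart _) eq))))
  covers′ : ∀ x → (∃[ a ] punchIn (D zero) (κ a) ≡ x) ⊎ (∃[ i ] D i ≡ x)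
  covers′ x with D zero ≟ x
  ... | yes eq = inj₂ (zero , eq)
  ... | no ≢x with covers (punchOut ≢x)
  ...   | inj₁ (a , eq) = inj₁ (a , trans (cong (punchIn (D zero)) eq) (punchIn-punchOut ≢x))
  ...   | inj₂ (i , eq) = inj₂ (suc i , punchOut-injective₂ i eq)
    where
    punchOut-injective₂ : ∀ i → punchOut (apart i) ≡ punchOut ≢x → D (suc i) ≡ x
    punchOut-injective₂ i = punchOut-injective (apart i) ≢x

complement-↔ : ∀ {j m} {D : Fin j → Fin m} → Injective _≡_ _≡_ D → (C : Complement D) →
               Fin (Complement.size C + j) ↔ Fin m
complement-↔ {D = D} D-injective C = ↔-trans +↔⊎ (⤖⇒↔ (mk⤖ {to = [ κ , D ]} (inj , surj)))
  where
  open Complement C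
  inj : Injective _≡_ _≡_ [ κ , D ]
  inj {inj₁ a} {inj₁ b} eq = cong inj₁ (injective eq)
  inj {inj₁ a} {inj₂ j} eq = contradiction eq (disjoint a j)
  inj {inj₂ i} {inj₁ b} eq = contradiction (sym eq) (disjoint b i)
  inj {inj₂ i} {inj₂ j} eq = cong inj₂ (D-injective eq)
  surj : Surjective _≡_ _≡_ [ κ , D ]
  surj x with covers x
  ... | inj₁ (a , refl) = inj₁ a , λ { refl → refl }
  ... | inj₂ (i , refl) = inj₂ i , λ { refl → refl }

record Reduction (G : Graph) : Set where
  field
    reduced   : Graph
    step      : Step reduced G
    smaller   : Graph.#edges reduced < Graph.#edges G
    connected : Connected reduced
    admissible    : Admissible reduced

module RemoveEar (G : Graph) (E : Ear G) where

  open Graph G using (ends)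
  open Ear E

  private
    D : Fin (suc k) → Edge G
    D = chord ∷ᶠ dup

    D-injective : Injective _≡_ _≡_ D
    D-injective {zero}  {zero}  _  = refl
    D-injective {zero}  {suc j} eq = contradiction eq (chord≢dup j)
    D-injective {suc i} {zero}  eq = contradiction (sym eq) (chord≢dup i)
    D-injective {suc i} {suc j} eq =
      cong suc (consecutiveEdges-injective G node-injective (dup-joins i) (dup-joins j) eq)

    keep∉D : ∀ i j → D j ≢ keep i
    keep∉D i zero    eq = chord≢keep i eq
    keep∉D i (suc j) eq with refl ← consecutiveEdges-injective G node-injective (dup-joins j) (keep-joins i) eq =
      keep≢dup i (sym eq)

    open module C = Complement (complement D D-injective)

    β : Fin (size + suc k) ↔ Edge G
    β = complement-↔ D-injective (complement D D-injective)

  G′ : Graph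
  G′ = record { #nodes = Graph.#nodes G ; #edges = size ; ends = ends ∘ κ }

  private
    kept : ∀ i → ∃[ a ] κ a ≡ keep i
    kept i with covers (keep i)
    ... | inj₁ p        = p
    ... | inj₂ (j , eq) = contradiction eq (keep∉D i j)

    kept-joins : ∀ i → Joins G′ (proj₁ (kept i)) (node (inject₁ i)) (node (suc i))
    kept-joins i = subst (λ e → Joins G e (node (inject₁ i)) (node (suc i))) (sym (proj₂ (kept i))) (keep-joins i)

  path : Path G′ k
  path = toPath G′ node-injective (proj₁ ∘ kept) kept-joins

  -- `β` lists the edges in the order of `addDoubleEar`: the remaining ones, the chord, the
  -- duplicates. The latter are copies of kept edges there, and agree with `dup` up to the order of
  -- the ends.
  iso : G ≅ addDoubleEar G′ path
  iso = record
    { nodes     = ↔-refl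
    ; edges     = ↔-sym β
    ; preserves = λ e → ∼-sym (∼-trans (inj₁ (cong ends (sym (strictlyInverseˡ e)))) (same (from e)))
    }
    where
    open Inverse β
    same : ∀ x → ends (to x) ∼ Graph.ends (addDoubleEar G′ path) x
    same x with splitAt size x
    ... | inj₁ a       = inj₁ refl
    ... | inj₂ zero    = chord-joins
    ... | inj₂ (suc i) = ∼-trans (dup-joins i) (∼-sym (kept-joins i))

  private
    -- A deleted duplicate is replaced by the edge kept beside it, the chord by a walk along the
    -- whole kept path.
    rerouted : ∀ {x y} → Adjacent G x y → Star (Adjacent G′) x y
    rerouted (e , j) with covers e
    ... | inj₁ (a , refl)     = (a , j) ◅ ε
    ... | inj₂ (suc i , refl) = (proj₁ (kept i) , ∼-trans (kept-joins i) (∼-trans (∼-sym (dup-joins i)) j)) ◅ ε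
    ... | inj₂ (zero , refl)  with ∼-trans (∼-sym chord-joins) j
    ...   | inj₁ refl = around
      where
      around : Star (Adjacent G′) (node zero) (node (fromℕ k))
      around = chain node (λ i → proj₁ (kept i) , kept-joins i) (fromℕ k)
    ...   | inj₂ refl = Star.reverse (adjacent-sym G′) (chain node (λ i → proj₁ (kept i) , kept-joins i) (fromℕ k))

  removal : Connected G → Tw₂ G → (∀ v → deg G v ≡ 4) → Reduction G
  removal conn t deg≡4 = record
    { reduced   = G′
    ; step      = doubleEarStep path deg≡2 iso
    ; smaller   = ℕ.<-≤-trans (ℕ.m<m+n size (s≤s z≤n)) (ℕ.≤-reflexive (↔⇒≡ β))
    ; connected = record
      { someNode  = Connected.someNode conn
      ; reachable = λ u w → Star.kleisliStar id rerouted (Connected.reachable conn u w)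
      }
    ; admissible    = record
      { isTree        = isTree
      ; decomposition = decomposition
      ; coversNodes   = coversNodes
      ; coversEdges   = λ (a , j) → coversEdges (κ a , j)
      } , deg24
    }
    where
    open Tw₂ t
    degH≡4 : ∀ v → deg (addDoubleEar G′ path) v ≡ 4
    degH≡4 v = trans (deg-≅ iso v) (deg≡4 v)
    deg≡2 : ∀ i → deg G′ (node i) ≡ 2
    -- The degree formula for adding the ear is read backwards: 4 after the addition means 2 before
    -- it.
    deg≡2 i = ℕ.+-cancelʳ-≡ 2 _ _ (trans (sym (deg-addDoubleEar-on G′ path i)) (degH≡4 (node i)))
    deg24 : Deg24 G′
    deg24 v with any? (λ i → node i ≟ v)
    ... | yes (i , refl) = inj₁ (deg≡2 i)
    ... | no off         = inj₂ (trans (sym (deg-addDoubleEar-off G′ path λ i eq → off (i , eq))) (degH≡4 v))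

-- Suppression of a node of degree 2

insert-at : ∀ {m n} i j (π : Perm.Permutation m n) → insert i j π ⟨$⟩ʳ i ≡ j
insert-at i j π with i ≟ i
... | yes _  = refl
... | no i≢i = contradiction refl i≢i

module Suppress
  {n m : ℕ} (ends : Vector (Fin (suc n) × Fin (suc n)) (suc m)) {v a b : Fin (suc n)} {e f : Fin (suc m)}
  (f≢e : f ≢ e) (v≢a : v ≢ a) (v≢b : v ≢ b) (e-joins : ends e ∼ (v , a)) (f-joins : ends f ∼ (v , b))
  (only : ∀ {g w} → ends g ∼ (v , w) → g ≡ e ⊎ g ≡ f) where

  private
    G : Graph
    G = record { #nodes = suc n ; #edges = suc m ; ends = ends }

    -- contracts f
    q : Fin (suc n) → Fin n
    q x with v ≟ x
    ... | yes _  = punchOut v≢b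
    ... | no v≢x = punchOut v≢x

    q-≢ : ∀ {x} → v ≢ x → punchIn v (q x) ≡ x
    q-≢ {x} v≢x with v ≟ x
    ... | yes v≡x = contradiction v≡x v≢x
    ... | no v≢x′ = punchIn-punchOut v≢x′

    q-punchIn : ∀ y → q (punchIn v y) ≡ y
    q-punchIn y = punchIn-injective v _ _ (q-≢ (punchInᵢ≢i v y ∘ sym))

    q-v : q v ≡ q b
    q-v with v ≟ v | v ≟ b
    ... | yes _  | no v≢b′ = punchOut-cong v refl
    ... | yes _  | yes v≡b = contradiction v≡b v≢b
    ... | no v≢v | _       = contradiction refl v≢v

    e′ : Fin m
    e′ = punchOut f≢e

    -- As `q v ≡ q b`, the edge `e` is mapped to this pair up to order. Overwriting it fixes the
    -- order, so that subdividing `e′` leaves `e` at `a` and puts the new edge, which is `f`, at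
    -- `b`.
    ends′ : Vector (Fin n × Fin n) m
    ends′ = updateAt (map q q ∘ ends ∘ punchIn f) e′ (const (q a , q b))

  G′ : Graph
  G′ = record { #nodes = n ; #edges = m ; ends = ends′ }

  private
    ends′-at : ends′ e′ ≡ (q a , q b)
    ends′-at = updateAt-updates e′ (map q q ∘ ends ∘ punchIn f)

    ends′-other : ∀ {i} → i ≢ e′ → ends′ i ≡ map q q (ends (punchIn f i))
    ends′-other {i} i≢e′ = updateAt-minimal i e′ (map q q ∘ ends ∘ punchIn f) i≢e′

    data EdgeView : Edge G → Set where
      is-f  : EdgeView f
      is-e  : EdgeView e
      other : ∀ i → i ≢ e′ → punchIn f i ≢ e → EdgeView (punchIn f i)

    edgeView : ∀ g → EdgeView g
    edgeView g with f ≟ g | e ≟ g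
    ... | yes refl | _        = is-f
    ... | no _     | yes refl = is-e
    ... | no f≢g   | no e≢g   = subst EdgeView (punchIn-punchOut f≢g)
      (other (punchOut f≢g) (λ eq → e≢g (sym (punchOut-injective f≢g f≢e eq)))
             (λ eq → e≢g (trans (sym eq) (punchIn-punchOut f≢g))))

    nodesπ : Perm.Permutation (suc n) (suc n)
    nodesπ = insert v zero Perm.id

    edgesπ : Perm.Permutation (suc m) (suc m)
    edgesπ = insert f zero Perm.id

    node-v : nodesπ ⟨$⟩ʳ v ≡ zero
    node-v = insert-at v zero Perm.id

    node-≢ : ∀ {x} → v ≢ x → nodesπ ⟨$⟩ʳ x ≡ suc (q x)
    node-≢ {x} v≢x = trans (cong (nodesπ ⟨$⟩ʳ_) (sym (q-≢ v≢x))) (insert-punchIn v zero Perm.id (q x))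

    edge-other : ∀ i → edgesπ ⟨$⟩ʳ punchIn f i ≡ suc i
    edge-other = insert-punchIn f zero Perm.id

    H : Graph
    H = subdivide G′ e′

    ends-H-f : Graph.ends H zero ≡ (zero , suc (q b))
    ends-H-f = cong (λ p → zero , suc (proj₂ p)) ends′-at

    ends-H-e : Graph.ends H (suc e′) ≡ (suc (q a) , zero)
    ends-H-e = trans (subdivide-ends-at G′ e′) (cong (λ p → suc (proj₁ p) , zero) ends′-at)

    preserves : ∀ {g} → EdgeView g → Graph.ends H (edgesπ ⟨$⟩ʳ g) ∼ map (nodesπ ⟨$⟩ʳ_) (nodesπ ⟨$⟩ʳ_) (ends g)
    preserves is-f rewrite insert-at f zero (Perm.id {m}) =
      ∼-trans (inj₁ (trans ends-H-f (sym (cong₂ _,_ node-v (node-≢ v≢b))))) (∼-map (nodesπ ⟨$⟩ʳ_) (∼-sym f-joins))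
    preserves is-e rewrite trans (cong (edgesπ ⟨$⟩ʳ_) (sym (punchIn-punchOut f≢e))) (edge-other e′) =
      ∼-trans (inj₁ (trans ends-H-e (sym (cong₂ _,_ (node-≢ v≢a) node-v)))) (∼-map (nodesπ ⟨$⟩ʳ_) (∼-sym (∼-swap e-joins)))
    preserves (other i i≢e′ g≢e) rewrite edge-other i =
      inj₁ (trans (subdivide-ends-other G′ i≢e′)
           (trans (cong (map suc suc) (ends′-other i≢e′))
                  (sym (cong₂ _,_ (node-≢ (avoids (inj₁ refl))) (node-≢ (avoids (inj₂ refl)))))))
      where
      avoids : ∀ {x y} → Joins G (punchIn f i) x y → v ≢ x
      avoids joins refl with only joins
      ... | inj₁ eq = g≢e eq
      ... | inj₂ eq = punchInᵢ≢i f i eq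

  iso : G ≅ subdivide G′ e′
  iso = record { nodes = nodesπ ; edges = edgesπ ; preserves = λ g → preserves (edgeView g) }

  private
    adjacent⁺ : ∀ {x y} → Adjacent G x y → q x ≡ q y ⊎ Adjacent G′ (q x) (q y)
    adjacent⁺ (g , joins) with edgeView g
    ... | other i i≢e′ _ = inj₂ (i , ∼-trans (inj₁ (ends′-other i≢e′)) (∼-map q joins))
    ... | is-e = inj₂ (e′ , ∼-trans (inj₁ (trans ends′-at (cong (q a ,_) (sym q-v))))
                          (∼-trans (inj₂ refl) (∼-map q (∼-trans (∼-sym e-joins) joins))))
    ... | is-f with ∼-trans (∼-sym f-joins) joins
    ...   | inj₁ refl = inj₁ q-v
    ...   | inj₂ refl = inj₁ (sym q-v)

    adjacent⁻ : ∀ {y z} → Adjacent G′ y z → ∃₂ λ x w → Adjacent G x w × (q x , q w) ∼ (y , z)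
    adjacent⁻ (i , joins) with i ≟ e′
    ... | yes refl = v , a , (e , e-joins) ,
      ∼-trans (inj₂ (cong (_, q a) q-v)) (∼-trans (inj₁ (sym ends′-at)) joins)
    ... | no i≢e′ = _ , _ , (punchIn f i , inj₁ refl) , ∼-trans (inj₁ (sym (ends′-other i≢e′))) joins

    connected : Connected G → Connected G′
    connected C = record
      { someNode  = q b
      ; reachable = λ x y → subst₂ (Star (Adjacent G′)) (q-punchIn x) (q-punchIn y)
                              (Star.kleisliStar q walk (reachable (punchIn v x) (punchIn v y)))
      }
      where
      open Connected C
      walk : ∀ {x y} → Adjacent G x y → Star (Adjacent G′) (q x) (q y)
      walk {x} xy with adjacent⁺ xy
      ... | inj₁ eq = subst (Star (Adjacent G′) (q x)) eq ε
      ... | inj₂ a  = a ◅ ε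

    tw₂ : Tw₂ G → Tw₂ G′
    tw₂ t = record
      { isTree        = isTree
      ; decomposition = D
      ; coversNodes   = λ y → subst (λ x → Together D x x) (q-punchIn y) (moved (coversNodes (punchIn v y)))
      ; coversEdges   = λ yz → covers (adjacent⁻ yz)
      }
      where
      open Tw₂ t
      Fibre : Node G → Node G → Set
      Fibre x y = q x ≡ q y × Together decomposition x y
      vb : Together decomposition v b
      vb = coversEdges (f , f-joins)
      -- Only `v` and `b` are identified, and they share a bag because `f` joins them.
      fibres : ∀ {x y} → q x ≡ q y → Star Fibre x y
      fibres {x} {y} eq = cases (v ≟ x) (v ≟ y)
        where
        q-injective : ∀ {x y} → v ≢ x → v ≢ y → q x ≡ q y → x ≡ y
        q-injective v≢x v≢y eq = trans (sym (q-≢ v≢x)) (trans (cong (punchIn v) eq) (q-≢ v≢y))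
        cases : Dec (v ≡ x) → Dec (v ≡ y) → Star Fibre x y
        cases (yes refl) (yes refl) = ε
        cases (no v≢x)   (no v≢y)   with refl ← q-injective v≢x v≢y eq = ε
        cases (yes refl) (no v≢y)   with refl ← q-injective v≢b v≢y (trans (sym q-v) eq) = (q-v , vb) ◅ ε
        cases (no v≢x)   (yes refl) with refl ← q-injective v≢x v≢b (trans eq q-v) =
          (sym q-v , Decomposition.together-sym decomposition vb) ◅ ε
      D : Decomposition tree (Node G′)
      D = minor decomposition q fibres
      moved : ∀ {x y} → Together decomposition x y → Together D (q x) (q y)
      moved = minor-together decomposition q fibres
      covers : ∀ {y z} → (∃₂ λ x w → Adjacent G x w × (q x , q w) ∼ (y , z)) → Together D y z
      covers (x , w , xw , inj₁ refl) = moved (coversEdges xw)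
      covers (x , w , xw , inj₂ refl) = Decomposition.together-sym D (moved (coversEdges xw))

    deg24 : Deg24 G → Deg24 G′
    deg24 d y = Sum.map (trans eq) (trans eq) (d (punchIn v y))
      where
      -- Read off the isomorphism with the subdivision, which preserves the degrees of old nodes,
      -- instead of being counted anew.
      eq : deg G′ y ≡ deg G (punchIn v y)
      eq = trans (sym (deg-subdivide-old G′ e′ y))
           (trans (cong (deg H) (sym (insert-punchIn v zero Perm.id y))) (deg-≅ iso (punchIn v y)))

  suppression : Connected G → Admissible G → Reduction G
  suppression conn (t , d) = record
    { reduced   = G′
    ; step      = subdivisionStep e′ iso
    ; smaller   = ℕ.n<1+n m
    ; connected = connected conn
    ; admissible    = tw₂ t , deg24 d
    }

-- The graph is matched on to expose its numbers of nodes and edges as successors, as renumbering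
-- after a deletion demands.
suppress : ∀ G {v a b} {e f : Edge G} → f ≢ e → v ≢ a → v ≢ b → Joins G e v a → Joins G f v b →
           (∀ {g w} → Joins G g v w → g ≡ e ⊎ g ≡ f) → Connected G → Admissible G → Reduction G
suppress record { #nodes = zero } {v = ()}
suppress record { #nodes = suc n ; #edges = zero } {e = ()}
suppress record { #nodes = suc n ; #edges = suc m ; ends = ends } f≢e v≢a v≢b e-joins f-joins only =
  Suppress.suppression ends f≢e v≢a v≢b e-joins f-joins only

-- The loop uses up the degree 2 of `v`, so every walk from `v` stays there.
loop-alone : ∀ {G v} {e : Edge G} → Connected G → deg G v ≡ 2 → Graph.ends G e ≡ (v , v) → G ≅ cycleGraph 0
loop-alone {G} {v} {e} conn deg≡2 loop = record
  { nodes     = mk↔ₛ′ (const zero) (const v) (λ { zero → refl }) onlyNode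
  ; edges     = mk↔ₛ′ (const zero) (const e) (λ { zero → refl })
                  λ e′ → sym (onlyEdge (inj₁ (cong (_, proj₂ (Graph.ends G e′)) (sym (onlyNode _)))))
  ; preserves = λ e → inj₁ refl
  }
  where
  open Connected conn
  onlyEdge : ∀ {e′ w} → Joins G e′ v w → e′ ≡ e
  onlyEdge {e′} joins with e ≟ e′
  ... | yes eq  = sym eq
  ... | no e≢e′ = contradiction (ℕ.≤-trans (ℕ.+-mono-≤ 2≤ (joins⇒1≤share G joins))
                    (ℕ.≤-trans (two≤sum _ e≢e′) (ℕ.≤-reflexive deg≡2))) λ { (s≤s (s≤s ())) }
    where
    2≤ : 2 ≤ share v (Graph.ends G e)
    2≤ rewrite loop | [≟]-refl v = s≤s (s≤s z≤n)
  stay : ∀ {w} → Star (Adjacent G) v w → v ≡ w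
  stay ε = refl
  stay ((e′ , joins) ◅ rest) with refl ← onlyEdge joins with ∼-trans (inj₁ (sym loop)) joins
  ... | inj₁ refl = stay rest
  ... | inj₂ refl = stay rest
  onlyNode : ∀ w → v ≡ w
  onlyNode w = stay (reachable v w)

-- Parallel edges, and the double ears of a 4-regular graph

Double : (G : Graph) → Node G → Node G → Set
Double G u w = ∃₂ λ e e′ → e ≢ e′ × Joins G e u w × Joins G e′ u w

record Triple (G : Graph) : Set where
  field
    {u w}          : Node G
    e₁ e₂ e₃       : Edge G
    distinct       : Unique (e₁ ∷ e₂ ∷ e₃ ∷ [])
    joins          : All (λ e → Joins G e u w) (e₁ ∷ e₂ ∷ e₃ ∷ [])

Loopless : Graph → Set
Loopless G = ∀ {v} → ¬ Adjacent G v v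

-- Of the ways to distribute four edges over two neighbours, only the even one avoids three edges on
-- the same side.
pigeonhole : ∀ G {v a b : Node G} {e₁ e₂ e₃ e₄} → Unique (e₁ ∷ e₂ ∷ e₃ ∷ e₄ ∷ []) →
             All (λ e → Joins G e v a ⊎ Joins G e v b) (e₁ ∷ e₂ ∷ e₃ ∷ e₄ ∷ []) →
             Triple G ⊎ (Double G v a × Double G v b)
pigeonhole G ((p₁₂ ∷ p₁₃ ∷ p₁₄ ∷ []) ∷ (p₂₃ ∷ p₂₄ ∷ []) ∷ (p₃₄ ∷ []) ∷ [] ∷ []) = λ where
    (inj₁ j₁ ∷ inj₁ j₂ ∷ inj₁ j₃ ∷ _       ∷ []) → inj₁ (triple p₁₂ p₁₃ p₂₃ j₁ j₂ j₃)
    (inj₁ j₁ ∷ inj₁ j₂ ∷ inj₂ j₃ ∷ inj₁ j₄ ∷ []) → inj₁ (triple p₁₂ p₁₄ p₂₄ j₁ j₂ j₄)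
    (inj₁ j₁ ∷ inj₁ j₂ ∷ inj₂ j₃ ∷ inj₂ j₄ ∷ []) → inj₂ ((_ , _ , p₁₂ , j₁ , j₂) , (_ , _ , p₃₄ , j₃ , j₄))
    (inj₁ j₁ ∷ inj₂ j₂ ∷ inj₁ j₃ ∷ inj₁ j₄ ∷ []) → inj₁ (triple p₁₃ p₁₄ p₃₄ j₁ j₃ j₄)
    (inj₁ j₁ ∷ inj₂ j₂ ∷ inj₁ j₃ ∷ inj₂ j₄ ∷ []) → inj₂ ((_ , _ , p₁₃ , j₁ , j₃) , (_ , _ , p₂₄ , j₂ , j₄))
    (inj₁ j₁ ∷ inj₂ j₂ ∷ inj₂ j₃ ∷ inj₁ j₄ ∷ []) → inj₂ ((_ , _ , p₁₄ , j₁ , j₄) , (_ , _ , p₂₃ , j₂ , j₃))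
    (_       ∷ inj₂ j₂ ∷ inj₂ j₃ ∷ inj₂ j₄ ∷ []) → inj₁ (triple p₂₃ p₂₄ p₃₄ j₂ j₃ j₄)
    (inj₂ j₁ ∷ inj₂ j₂ ∷ inj₂ j₃ ∷ inj₁ j₄ ∷ []) → inj₁ (triple p₁₂ p₁₃ p₂₃ j₁ j₂ j₃)
    (inj₂ j₁ ∷ inj₂ j₂ ∷ inj₁ j₃ ∷ inj₂ j₄ ∷ []) → inj₁ (triple p₁₂ p₁₄ p₂₄ j₁ j₂ j₄)
    (inj₂ j₁ ∷ inj₂ j₂ ∷ inj₁ j₃ ∷ inj₁ j₄ ∷ []) → inj₂ ((_ , _ , p₃₄ , j₃ , j₄) , (_ , _ , p₁₂ , j₁ , j₂))
    (inj₂ j₁ ∷ inj₁ j₂ ∷ inj₂ j₃ ∷ inj₂ j₄ ∷ []) → inj₁ (triple p₁₃ p₁₄ p₃₄ j₁ j₃ j₄)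
    (inj₂ j₁ ∷ inj₁ j₂ ∷ inj₂ j₃ ∷ inj₁ j₄ ∷ []) → inj₂ ((_ , _ , p₂₄ , j₂ , j₄) , (_ , _ , p₁₃ , j₁ , j₃))
    (inj₂ j₁ ∷ inj₁ j₂ ∷ inj₁ j₃ ∷ inj₂ j₄ ∷ []) → inj₂ ((_ , _ , p₂₃ , j₂ , j₃) , (_ , _ , p₁₄ , j₁ , j₄))
    (inj₂ j₁ ∷ inj₁ j₂ ∷ inj₁ j₃ ∷ inj₁ j₄ ∷ []) → inj₁ (triple p₂₃ p₂₄ p₃₄ j₂ j₃ j₄)
  where
  triple : ∀ {u w e₁ e₂ e₃} → e₁ ≢ e₂ → e₁ ≢ e₃ → e₂ ≢ e₃ →
           Joins G e₁ u w → Joins G e₂ u w → Joins G e₃ u w → Triple G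
  triple p q r j₁ j₂ j₃ = record { distinct = (p ∷ q ∷ []) ∷ (r ∷ []) ∷ [] ∷ [] ; joins = j₁ ∷ j₂ ∷ j₃ ∷ [] }

notLoop : ∀ {G v e} → Loopless G → Graph.ends G e ≢ (v , v)
notLoop loopless eq = loopless (_ , inj₁ eq)

fourEdges : ∀ G {v} → Loopless G → deg G v ≡ 4 →
            ∃₂ λ e₁ e₂ → ∃₂ λ e₃ e₄ → Unique (e₁ ∷ e₂ ∷ e₃ ∷ e₄ ∷ []) ×
            All (λ e → ∃[ w ] Joins G e v w) (e₁ ∷ e₂ ∷ e₃ ∷ e₄ ∷ [])
fourEdges G {v} loopless deg≡4 = list elements (trans size deg≡4) unique positive
  where
  open Support (support (share v ∘ Graph.ends G) λ e → share≤1 _ (notLoop {G} loopless))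
  list : ∀ es → length es ≡ 4 → Unique es → All (λ e → 1 ≤ share v (Graph.ends G e)) es →
         ∃₂ λ e₁ e₂ → ∃₂ λ e₃ e₄ → Unique (e₁ ∷ e₂ ∷ e₃ ∷ e₄ ∷ []) ×
         All (λ e → ∃[ w ] Joins G e v w) (e₁ ∷ e₂ ∷ e₃ ∷ e₄ ∷ [])
  list (_ ∷ _ ∷ _ ∷ _ ∷ []) _ uq pos = _ , _ , _ , _ , uq , All.map (1≤share⇒∼ _) pos

pinched : ∀ G (t : Tw₂ G) → Loopless G → (∀ v → deg G v ≡ 4) →
          Pinched (Tw₂.decomposition t) (Triple G) (Adjacent G) (Double G)
pinched G t loopless deg≡4 = record
  { sym₁    = adjacent-sym G
  ; sym₂    = λ (e , e′ , e≢e′ , j , j′) → e , e′ , e≢e′ , ∼-swap j , ∼-swap j′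
  ; weaken  = λ (e , _ , _ , j , _) → e , j
  ; R₁?     = λ u w → any? λ e → ≡-dec _≟_ _≟_ (Graph.ends G e) (u , w)
                              ⊎-dec ≡-dec _≟_ _≟_ (Graph.ends G e) (w , u)
  ; irrefl  = loopless
  ; covered = Tw₂.coversEdges t
  ; pinch   = λ _ → pinch
  }
  where
  pinch : ∀ {v a b} → (∀ {w} → Adjacent G v w → w ≡ a ⊎ w ≡ b) →
          Triple G ⊎ (a ≢ b × Double G v a × Double G v b)
  pinch {v} {a} {b} nbrs with fourEdges G loopless (deg≡4 v) | a ≟ b
  ... | _ , _ , _ , _ , uq , joins | no a≢b = Sum.map₂ (a≢b ,_) (pigeonhole G uq (All.map classify joins))
    where
    classify : ∀ {e} → ∃[ w ] Joins G e v w → Joins G e v a ⊎ Joins G e v b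
    classify {e} (w , joins) with nbrs (e , joins)
    ... | inj₁ refl = inj₁ joins
    ... | inj₂ refl = inj₂ joins
  -- With a single neighbour all four edges are parallel, and any three of them form a triple edge.
  ... | _ , _ , _ , _ , uq , joins | yes refl =
    inj₁ (record { distinct = Unique.take⁺ 3 uq ; joins = All.take⁺ 3 (All.map classify joins) })
    where
    classify : ∀ {e} → ∃[ w ] Joins G e v w → Joins G e v a
    classify {e} (w , joins) with nbrs (e , joins)
    ... | inj₁ refl = joins
    ... | inj₂ refl = joins

loopEar : ∀ G {v} → Adjacent G v v → Ear G
loopEar G {v} (e , joins) = record
  { node           = λ (_ : Fin 1) → v
  ; node-injective = λ { {zero} {zero} _ → refl }
  ; chord          = e
  ; keep           = λ ()
  ; dup            = λ ()
  ; chord-joins    = joins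
  ; keep-joins     = λ ()
  ; dup-joins      = λ ()
  ; keep≢dup       = λ ()
  ; chord≢keep     = λ ()
  ; chord≢dup      = λ ()
  }

-- The chord of a path with one edge is parallel to that edge, so three parallel edges serve as
-- chord, kept edge and duplicate.
tripleEar : ∀ G → Loopless G → Triple G → Ear G
tripleEar G loopless record { u = u ; w = w ; e₁ = e₁ ; e₂ = e₂ ; e₃ = e₃
                            ; distinct = (p₁₂ ∷ p₁₃ ∷ []) ∷ (p₂₃ ∷ []) ∷ [] ∷ [] ; joins = j₁ ∷ j₂ ∷ j₃ ∷ [] } = record
  { node           = lookup (u ∷ w ∷ [])
  ; node-injective = lookup-injective ((u≢w ∷ []) ∷ [] ∷ [])
  ; chord          = e₁
  ; keep           = const e₂
  ; dup            = const e₃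
  ; chord-joins    = j₁
  ; keep-joins     = λ { zero → j₂ }
  ; dup-joins      = λ { zero → j₃ }
  ; keep≢dup       = λ _ → p₂₃
  ; chord≢keep     = λ _ → p₁₂
  ; chord≢dup      = λ _ → p₁₃
  }
  where
  u≢w : u ≢ w
  u≢w refl = loopless (e₁ , j₁)

-- Here the bound 2 in `Long` pays off: the ends of the path are not consecutive, which separates
-- the chord from all doubled edges.
longEar : ∀ G → Long (Adjacent G) (Double G) → Ear G
longEar G (x , z , ys , w , uq , 2≤ , chord , joins) = record
  { node           = N
  ; node-injective = N-injective
  ; chord          = chord
  ; keep           = λ i → proj₁ (walk-step w i)
  ; dup            = λ i → proj₁ (proj₂ (walk-step w i))
  ; chord-joins    = chord-joins
  ; keep-joins     = keep-joins
  ; dup-joins      = dup-joins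
  ; keep≢dup       = λ i → let _ , _ , e≢e′ , _ = walk-step w i in e≢e′
  ; chord≢keep     = λ i → closingEdge G N-injective long chord-joins (keep-joins i)
  ; chord≢dup      = λ i → closingEdge G N-injective long chord-joins (dup-joins i)
  }
  where
  N : Fin (suc (length ys)) → Node G
  N = lookup (x ∷ ys)
  N-injective : Injective _≡_ _≡_ N
  N-injective = lookup-injective uq
  long : length ys ≢ 1
  long eq = contradiction (ℕ.≤-trans 2≤ (ℕ.≤-reflexive eq)) λ { (s≤s ()) }
  chord-joins : Joins G chord (N zero) (N (fromℕ (length ys)))
  chord-joins = subst (Joins G chord x) (sym (walk-end w)) joins
  keep-joins : ∀ i → Joins G (proj₁ (walk-step w i)) (N (inject₁ i)) (N (suc i))
  keep-joins i = let _ , _ , _ , j , _ = walk-step w i in j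
  dup-joins : ∀ i → Joins G (proj₁ (proj₂ (walk-step w i))) (N (inject₁ i)) (N (suc i))
  dup-joins i = let _ , _ , _ , _ , j′ = walk-step w i in j′

findEar : ∀ G → Connected G → Tw₂ G → (∀ v → deg G v ≡ 4) → Ear G
findEar G conn t deg≡4 with any? (λ e → proj₁ (Graph.ends G e) ≟ proj₂ (Graph.ends G e))
... | yes (e , eq) = loopEar G (e , inj₁ (cong (_, proj₂ (Graph.ends G e)) eq))
... | no ¬loop     =
  [ tripleEar G loopless , longEar G ] (findLong isTree _≟_ _ (allFin _) ℕ.≤-refl (pinched G t loopless deg≡4)
    (λ _ → ∈-allFin _) (Connected.someNode conn , coversNodes _))
  where
  open Tw₂ t
  loopless : Loopless G
  loopless (e , inj₁ eq) = ¬loop (e , trans (cong proj₁ eq) (sym (cong proj₂ eq)))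
  loopless (e , inj₂ eq) = ¬loop (e , trans (cong proj₁ eq) (sym (cong proj₂ eq)))

-- Without a loop at `v`, degree 2 means two edges. Their other ends may coincide; the suppression
-- then produces a loop.
suppressAt : ∀ G {v} → Connected G → Admissible G → deg G v ≡ 2 → (∀ e → Graph.ends G e ≢ (v , v)) → Reduction G
suppressAt G {v} conn admissible deg≡2 noLoop = twoEdges elements (trans size deg≡2) unique positive complete
  where
  open Support (support (share v ∘ Graph.ends G) λ e → share≤1 _ (noLoop e))
  distinct : ∀ {e w} → Joins G e v w → v ≢ w
  distinct {e} (inj₁ eq) refl = noLoop e eq
  distinct {e} (inj₂ eq) refl = noLoop e eq
  twoEdges : ∀ es → length es ≡ 2 → Unique es → All (λ e → 1 ≤ share v (Graph.ends G e)) es →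
             (∀ {e} → 1 ≤ share v (Graph.ends G e) → e ∈ es) → Reduction G
  twoEdges (e ∷ f ∷ []) _ ((e≢f ∷ []) ∷ _) (pₑ ∷ p_f ∷ []) complete
    with 1≤share⇒∼ _ pₑ | 1≤share⇒∼ _ p_f
  ... | a , jₑ | b , j_f = suppress G (≢-sym e≢f) (distinct jₑ) (distinct j_f) jₑ j_f only conn admissible
    where
    only : ∀ {g w} → Joins G g v w → g ≡ e ⊎ g ≡ f
    only j with complete (joins⇒1≤share G j)
    ... | here eq         = inj₁ eq
    ... | there (here eq) = inj₂ eq

reduce : ∀ G → Connected G → Admissible G → IsCycle G ⊎ Reduction G
reduce G conn admissible@(t , d) with any? (λ v → deg G v ℕ.≟ 2)
... | no ¬2 = inj₂ (RemoveEar.removal G (findEar G conn t deg≡4) conn t deg≡4)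
  where
  deg≡4 : ∀ v → deg G v ≡ 4
  deg≡4 v with d v
  ... | inj₁ eq = contradiction (v , eq) ¬2
  ... | inj₂ eq = eq
... | yes (v , deg≡2) with any? (λ e → ≡-dec _≟_ _≟_ (Graph.ends G e) (v , v))
...   | yes (e , loop) = inj₁ (0 , loop-alone conn deg≡2 loop)
...   | no ¬loop       = inj₂ (suppressAt G conn admissible deg≡2 λ e eq → ¬loop (e , eq))

-- The induction is on the number of edges, because removing a double ear keeps all nodes.
admissible⇒decomposable : ∀ fuel G → Graph.#edges G < fuel → Connected G → Admissible G → DoubleEarDecomposable G
admissible⇒decomposable (suc fuel) G lt conn admissible with reduce G conn admissible
... | inj₁ cycle = G , cycle , ε
... | inj₂ r     =
  let G₀ , cycle , steps = admissible⇒decomposable fuel reduced (ℕ.<-≤-trans smaller (s≤s⁻¹ lt)) connected admissible′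
  in G₀ , cycle , steps ◅◅ step ◅ ε
  where open Reduction r renaming (admissible to admissible′)

theorem11 : (G : Graph) → Connected G →
    DoubleEarDecomposable G ⇔ (tw[ G ]≤ 2 × (∀ v → deg G v ≡ 2 ⊎ deg G v ≡ 4))
theorem11 G conn = mk⇔
  (map₁ Tw₂⇒tw≤2 ∘ decomposable⇒admissible)
  (λ (tw , d) → admissible⇒decomposable _ G (ℕ.n<1+n _) conn (tw≤2⇒Tw₂ tw , d))
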